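{- Consider the nonpreemptive Lazy Bureaucrat Problem restricted to instances in which all jobs are released at time zero ($a_i=0$ for all $i$), and let $K=\max_i d_i$. For each of the objectives (1), (2) and (3), an optimal feasible schedule can be computed in $O(K\cdot n)$ time.
   Context: An instance of the Lazy Bureaucrat Problem (LBP) consists of jobs $1,\dots,n$; job $i$ has a processing time $t_i$, an arrival time $a_i$ and a deadline $d_i$, all nonnegative integers. Its critical time is $c_i=d_i-t_i$. A single processor (the bureaucrat) processes at most one job at a time. In the nonpreemptive setting, a schedule chooses a set of executed jobs and, for each executed job $i$, a start time $s_i$ with $a_i\le s_i\le c_i$; job $i$ is then processed without interruption during $[s_i,s_i+t_i)$, these intervals are pairwise disjoint, and each job is executed at most once. A job $i$ is executable at time $\tau$ if it has not been started before $\tau$ and $a_i\le\tau\le c_i$. A schedule is feasible if it satisfies the busy requirement: at every time $\tau$ at which the processor is not processing a job, no job is executable. The objectives, each to be minimized over feasible schedules, are: (1) the total time spent working, $\sum t_i$ over executed jobs; (2) the weighted sum of completed jobs, where job $i$ has weight $t_i$; (3) the makespan, i.e. the largest completion time $s_i+t_i$ of an executed job.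
   Formalization: Since zero processing times are allowed, some instances have no feasible schedule (e.g. one job with t=d=0); exactly then the algorithm reports this instead. The bound is read as O(max(1,K)·max(1,n)), and time is rational, which is equivalent here. -}

module Defs where

open import Data.Bool using (if_then_else_)
open import Data.Fin using (Fin; zero; suc; toℕ)
open import Data.Integer using (+_)
open import Data.Maybe using (Maybe; just; nothing; maybe′)
open import Data.Nat using (ℕ; zero; suc)
open import Data.Product using (_×_; ∃; ∃-syntax)
open import Data.Rational using (ℚ; 0ℚ; _/_; _+_; _-_; _≤_; _<_; _⊔_; _≤?_)
open import Function using (_∘_)
open import Relation.Binary.PropositionalEquality using (_≡_; _≢_)
open import Relation.Nullary using (¬_; does)
import Data.Nat as ℕ
import Data.Vec.Functional as Vector

-- The data of an instance are natural numbers; the time axis is ℚ, so that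
-- start times, and the instants at which the busy requirement is imposed,
-- are not confined to integers.

record Instance : Set where
  field
    n          : ℕ
    processing : Fin n → ℕ
    arrival    : Fin n → ℕ
    deadline   : Fin n → ℕ

fromℕ : ℕ → ℚ
fromℕ k = + k / 1

Schedule : Instance → Set
Schedule I = Fin (Instance.n I) → Maybe ℚ

module _ (I : Instance) where
  open Instance I

  t a d c : Fin n → ℚ
  t i = fromℕ (processing i)
  a i = fromℕ (arrival i)
  d i = fromℕ (deadline i)
  c i = d i - t i

  ReleasedAtZero : Set
  ReleasedAtZero = ∀ i → arrival i ≡ 0

  -- Equals 0 when there are no jobs.
  maxDeadline : ℕ
  maxDeadline = Vector.foldr ℕ._⊔_ 0 deadline

  module _ (σ : Schedule I) where

    StartsAt : Fin n → ℚ → Set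
    StartsAt i s = σ i ≡ just s

    InProcess : Fin n → ℚ → Set
    InProcess i τ = ∃[ s ] StartsAt i s × s ≤ τ × τ < s + t i

    StartedBefore : Fin n → ℚ → Set
    StartedBefore i τ = ∃[ s ] StartsAt i s × s < τ

    Executable : Fin n → ℚ → Set
    Executable i τ = ¬ StartedBefore i τ × a i ≤ τ × τ ≤ c i

    record Feasible : Set where
      field
        window   : ∀ i s → StartsAt i s → a i ≤ s × s ≤ c i
        disjoint : ∀ i j → i ≢ j → ∀ τ → ¬ (InProcess i τ × InProcess j τ)
        busy     : ∀ τ → ¬ (∃[ i ] InProcess i τ) → ∀ j → ¬ Executable j τ

data Objective : Set where
  totalWork weightedCompleted makespan : Objective

module _ (I : Instance) (σ : Schedule I) where
  open Instance I

  -- The makespan of a schedule executing no job is 0.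
  value : Objective → ℚ
  value totalWork =
    Vector.foldr _+_ 0ℚ λ i → maybe′ (λ _ → t I i) 0ℚ (σ i)
  value weightedCompleted =
    Vector.foldr _+_ 0ℚ λ i →
      maybe′ (λ s → if does (s + t I i ≤? d I i) then t I i else 0ℚ) 0ℚ (σ i)
  value makespan =
    Vector.foldr _⊔_ 0ℚ λ i → maybe′ (λ s → s + t I i) 0ℚ (σ i)

Optimal : Objective → (I : Instance) → Schedule I → Set
Optimal obj I σ =
  Feasible I σ × (∀ σ′ → Feasible I σ′ → value I σ obj ≤ value I σ′ obj)

-- Processing times may be 0. A zero-length job never occupies the processor
-- and is not started *before* its own start time, so an instance such as a
-- single job with t = 0 has no feasible schedule. `nothing` reports this
-- situation, and is acceptable only when a zero-length job is present.

Correct : Objective → (I : Instance) → Maybe (Schedule I) → Set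
Correct obj I (just σ) = Optimal obj I σ
Correct obj I nothing  =
  (∃[ i ] Instance.processing I i ≡ 0) × ¬ (∃[ σ ] Feasible I σ)

-- Unit-cost random access machine, in structured form: natural-number
-- registers and arrays, with addition and truncated subtraction as the only
-- arithmetic. A program is a finite term independent of the input, so it names
-- finitely many registers and arrays.

infixl 6 _⊕_ _⊖_
infix  8 _[_]
infix  4 _≔_ _[_]≔_
infixr 2 _⨾_
infix  3 ifnz_then_else_ while_loop_

data Expr : Set where
  const : ℕ → Expr
  reg   : ℕ → Expr
  _[_]  : ℕ → Expr → Expr
  _⊕_   : Expr → Expr → Expr
  _⊖_   : Expr → Expr → Expr

data Program : Set where
  skip            : Program
  _≔_             : ℕ → Expr → Program
  _[_]≔_          : ℕ → Expr → Expr → Program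
  _⨾_             : Program → Program → Program
  ifnz_then_else_ : Expr → Program → Program → Program
  while_loop_     : Expr → Program → Program

record State : Set where
  constructor ⟨_,_⟩
  field
    regs : ℕ → ℕ
    arrs : ℕ → ℕ → ℕ

update : {A : Set} → (ℕ → A) → ℕ → A → ℕ → A
update f x v y = if does (y ℕ.≟ x) then v else f y

setReg : State → ℕ → ℕ → State
setReg ⟨ r , m ⟩ x v = ⟨ update r x v , m ⟩

setArr : State → ℕ → ℕ → ℕ → State
setArr ⟨ r , m ⟩ A k v = ⟨ r , update m A (update (m A) k v) ⟩

eval : State → Expr → ℕ
eval s (const k) = k
eval s (reg x)   = State.regs s x
eval s (A [ e ]) = State.arrs s A (eval s e)
eval s (e ⊕ f)   = eval s e ℕ.+ eval s f
eval s (e ⊖ f)   = eval s e ℕ.∸ eval s f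

-- One time unit per node of an expression.
cost : Expr → ℕ
cost (const _) = 1
cost (reg _)   = 1
cost (_ [ e ]) = suc (cost e)
cost (e ⊕ f)   = suc (cost e ℕ.+ cost f)
cost (e ⊖ f)   = suc (cost e ℕ.+ cost f)

-- Run p s s′ k: p started in s halts in s′ after k time units. Conditions
-- hold when nonzero, and every test of a condition is charged.
data Run : Program → State → State → ℕ → Set where
  skip : ∀ {s} → Run skip s s 1
  assign : ∀ {s x e} →
    Run (x ≔ e) s (setReg s x (eval s e)) (suc (cost e))
  store : ∀ {s A e f} →
    Run (A [ e ]≔ f) s (setArr s A (eval s e) (eval s f)) (suc (cost e ℕ.+ cost f))
  seq : ∀ {p q s s′ s″ k l} →
    Run p s s′ k → Run q s′ s″ l → Run (p ⨾ q) s s″ (k ℕ.+ l)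
  if-true : ∀ {e p q s s′ k} → eval s e ≢ 0 →
    Run p s s′ k → Run (ifnz e then p else q) s s′ (suc (cost e ℕ.+ k))
  if-false : ∀ {e p q s s′ k} → eval s e ≡ 0 →
    Run q s s′ k → Run (ifnz e then p else q) s s′ (suc (cost e ℕ.+ k))
  while-true : ∀ {e p s s′ s″ k l} → eval s e ≢ 0 →
    Run p s s′ k → Run (while e loop p) s′ s″ l →
    Run (while e loop p) s s″ (suc (cost e ℕ.+ (k ℕ.+ l)))
  while-false : ∀ {e p s} → eval s e ≡ 0 →
    Run (while e loop p) s s (suc (cost e))

pad : ∀ {n} → (Fin n → ℕ) → ℕ → ℕ
pad {zero}  f k       = 0
pad {suc n} f zero    = f zero
pad {suc n} f (suc k) = pad (f ∘ suc) k

-- Input convention: register 0 holds n; arrays 0, 1, 2 hold the processing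
-- times, arrival times and deadlines; all other cells are 0.
input : Instance → State
input I = ⟨ regs , arrs ⟩
  where
  open Instance I
  regs : ℕ → ℕ
  regs 0 = n
  regs _ = 0
  arrs : ℕ → ℕ → ℕ
  arrs 0 = pad processing
  arrs 1 = pad arrival
  arrs 2 = pad deadline
  arrs _ = λ _ → 0

-- Output convention: register 0 is nonzero iff a schedule is returned; then
-- job i is executed iff cell i of array 3 is nonzero, and its start time is
-- cell i of array 4.
output : (I : Instance) → State → Maybe (Schedule I)
output I ⟨ r , m ⟩ =
  if r 0 ℕ.≡ᵇ 0 then nothing else just λ i →
    if m 3 (toℕ i) ℕ.≡ᵇ 0 then nothing else just (fromℕ (m 4 (toℕ i)))

{-# OPTIONS --safe #-}

-- Jobs with t > d are never executable, and zero-length jobs can all be started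
-- at time 0 as soon as some other job runs; call the remaining jobs relevant.
-- If W is the total length of the relevant jobs that a feasible schedule
-- executes, some instant of [ 0 , W ] is idle, so every relevant job it omits has
-- critical time below W; and as the executed ones occupy disjoint intervals,
-- those due by D have total length at most D. Hence they can be run in order of
-- deadlines without gaps during [ 0 , W ), and this schedule has value W for all
-- three objectives, which is optimal for the given set. It remains to find
-- the least W for which such a set exists. Processing the jobs by deadline, the
-- table entry for (r , x) is the least v such that some subset of the first r
-- jobs has total length x, meets its deadlines and omits only jobs with critical
-- time below v; a makespan T is attainable iff the last row satisfies v ≤ T at T.

module Submission where

open import Defs
open import Data.Bool using (if_then_else_; true; false)
open import Data.Fin using (Fin; zero; suc; toℕ; fromℕ<)
open import Data.Fin.Properties using (fromℕ<-injective; injective⇒≤; toℕ-fromℕ<; toℕ-injective; toℕ<n)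
open import Data.Integer using (+≤+; +<+)
open import Data.List using (List; []; _∷_; map)
open import Data.List.Membership.Propositional using (_∈_; _∉_)
open import Data.List.Properties using (map-cong-local)
open import Data.List.Relation.Binary.Permutation.Propositional using (↭-sym; ↭⇒↭ₛ)
open import Data.List.Relation.Binary.Permutation.Propositional.Properties using (All-resp-↭; map⁺)
open import Data.List.Relation.Unary.All as All using (All; []; _∷_)
open import Data.List.Relation.Unary.AllPairs as AllPairs using (AllPairs; []; _∷_)
open import Data.List.Relation.Unary.Any using (here; there)
open import Data.List.Relation.Unary.Sorted.TotalOrder.Properties using (Sorted⇒AllPairs)
open import Data.Maybe using (Maybe; just; nothing; maybe′)
open import Data.Maybe.Properties using (just-injective)
open import Data.Nat using (ℕ; zero; suc; _≤_; _<_; _+_; _*_; _∸_; _⊔_; _⊓_; _≡ᵇ_; _≤ᵇ_; _≟_; _≤?_; z≤n; s≤s; >-nonZero)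
open import Data.List.Membership.DecPropositional _≟_ using (_∈?_)
open import Data.Nat.ListAction using (sum)
open import Data.Nat.ListAction.Properties using (sum-↭)
open import Data.Nat.Properties
open import Data.Product using (_×_; _,_; proj₁; proj₂; ∃-syntax; Σ-syntax)
open import Data.Rational using (ℚ; 0ℚ; mkℚ; *≤*; *<*)
open import Data.Sum using (_⊎_; inj₁; inj₂)
open import Function using (_∘_; id; case_of_)
open import Relation.Binary.Bundles using (DecTotalOrder)
open import Relation.Binary.Definitions using (tri<; tri≈; tri>)
open import Relation.Binary.PropositionalEquality using (_≡_; _≢_; refl; sym; trans; cong; cong-app; cong₂; subst; subst₂; setoid; module ≡-Reasoning)
open import Relation.Nullary using (¬_; yes; no; contradiction; does)
open import Relation.Nullary.Decidable using (dec-true; dec-false)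
open import Relation.Unary using (Decidable)
import Data.Bool as Bool
import Data.Integer as ℤ
import Data.Integer.Properties as ℤ
import Data.List.Relation.Binary.Permutation.Setoid.Properties as PermSetoid
import Data.List.Sort as Sort
import Data.Nat.Coprimality as Coprime
import Data.Rational as ℚ
import Data.Rational.Properties as ℚ
import Data.Vec.Functional as Vector
import Relation.Binary.Construct.On as On

-- Rational instants and intervals

-- Whether an omitted job is harmless depends on the final total length, which is unknown while the
-- table is being filled, and a further table dimension for it would break the time bound. Storing
-- the least admissible threshold makes the entries independent of that total; the two meet only on
-- the diagonal. That the comparison succeeds somewhere follows from a greedy choice, which takes
-- every job that still fits. The table is shown to lie below every selection. That a small entry is
-- really achieved is established by the reconstruction loop, which unwinds the recurrence and
-- leaves a plan in the arrays. The machine shapes the formulas: it tests only for zero and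
-- subtracts with truncation, so conjunctions of inequalities become sums of differences; it does
-- not multiply, so addresses are accumulated row by row. The infeasible instances are those with a
-- zero-length job and no relevant job.

fromℕ≡mkℚ : ∀ k → fromℕ k ≡ mkℚ (ℤ.+ k) 0 (Coprime.sym (Coprime.1-coprimeTo k))
fromℕ≡mkℚ k = ℚ.normalize-coprime (Coprime.sym (Coprime.1-coprimeTo k))

fromℕ-mono-≤ : ∀ {k l} → k ≤ l → fromℕ k ℚ.≤ fromℕ l
fromℕ-mono-≤ {k} {l} k≤l = subst₂ ℚ._≤_ (sym (fromℕ≡mkℚ k)) (sym (fromℕ≡mkℚ l))
  (*≤* (subst₂ ℤ._≤_ (sym (ℤ.*-identityʳ (ℤ.+ k))) (sym (ℤ.*-identityʳ (ℤ.+ l))) (+≤+ k≤l)))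

fromℕ-mono-< : ∀ {k l} → k < l → fromℕ k ℚ.< fromℕ l
fromℕ-mono-< {k} {l} k<l = subst₂ ℚ._<_ (sym (fromℕ≡mkℚ k)) (sym (fromℕ≡mkℚ l))
  (*<* (subst₂ ℤ._<_ (sym (ℤ.*-identityʳ (ℤ.+ k))) (sym (ℤ.*-identityʳ (ℤ.+ l))) (+<+ k<l)))

fromℕ-cancel-≤ : ∀ {k l} → fromℕ k ℚ.≤ fromℕ l → k ≤ l
fromℕ-cancel-≤ {k} {l} p with subst₂ ℚ._≤_ (fromℕ≡mkℚ k) (fromℕ≡mkℚ l) p
... | *≤* q = ℤ.drop‿+≤+ (subst₂ ℤ._≤_ (ℤ.*-identityʳ (ℤ.+ k)) (ℤ.*-identityʳ (ℤ.+ l)) q)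

fromℕ-+ : ∀ k l → fromℕ (k + l) ≡ fromℕ k ℚ.+ fromℕ l
fromℕ-+ k l rewrite fromℕ≡mkℚ k | fromℕ≡mkℚ l =
  cong (λ z → z ℚ./ 1) (sym (cong₂ ℤ._+_ (ℤ.*-identityʳ (ℤ.+ k)) (ℤ.*-identityʳ (ℤ.+ l))))

0≤fromℕ : ∀ k → 0ℚ ℚ.≤ fromℕ k
0≤fromℕ k = fromℕ-mono-≤ {0} {k} z≤n

p≤p+fromℕ : ∀ p k → p ℚ.≤ p ℚ.+ fromℕ k
p≤p+fromℕ p k = subst (ℚ._≤ p ℚ.+ fromℕ k) (ℚ.+-identityʳ p) (ℚ.+-monoʳ-≤ p (0≤fromℕ k))

p-q+q≡p : ∀ p q → (p ℚ.- q) ℚ.+ q ≡ p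
p-q+q≡p p q = trans (ℚ.+-assoc p (ℚ.- q) q)
  (trans (cong (p ℚ.+_) (ℚ.+-inverseˡ q)) (ℚ.+-identityʳ p))

p+q-q≡p : ∀ p q → (p ℚ.+ q) ℚ.- q ≡ p
p+q-q≡p p q = trans (ℚ.+-assoc p q (ℚ.- q))
  (trans (cong (p ℚ.+_) (ℚ.+-inverseʳ q)) (ℚ.+-identityʳ p))

p≤q-r⇒p+r≤q : ∀ p q r → p ℚ.≤ q ℚ.- r → p ℚ.+ r ℚ.≤ q
p≤q-r⇒p+r≤q p q r h = subst (p ℚ.+ r ℚ.≤_) (p-q+q≡p q r) (ℚ.+-monoˡ-≤ r h)

p+r≤q⇒p≤q-r : ∀ p q r → p ℚ.+ r ℚ.≤ q → p ℚ.≤ q ℚ.- r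
p+r≤q⇒p≤q-r p q r h = subst (ℚ._≤ q ℚ.- r) (p+q-q≡p p r) (ℚ.+-monoˡ-≤ (ℚ.- r) h)

-- Half-open intervals [ s , s + t ), given by start and integer length.
Interval : Set
Interval = ℚ × ℕ

end : Interval → ℚ
end (s , t) = s ℚ.+ fromℕ t

Covers : ℚ → Interval → Set
Covers τ (s , t) = s ℚ.≤ τ × τ ℚ.< s ℚ.+ fromℕ t

Disjoint : Interval → Interval → Set
Disjoint u v = ∀ τ → ¬ (Covers τ u × Covers τ v)

totalLength : List Interval → ℕ
totalLength us = sum (map proj₂ us)

byStart : DecTotalOrder _ _ _
byStart = On.decTotalOrder ℚ.≤-decTotalOrder (proj₁ {B = λ (_ : ℚ) → ℕ})

open Sort byStart using (sort; sort-↭; sort-↗)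

Sorted : List Interval → Set
Sorted = AllPairs (λ u v → proj₁ u ℚ.≤ proj₁ v)

sort-sorted : ∀ us → Sorted (sort us)
sort-sorted us = Sorted⇒AllPairs (DecTotalOrder.totalOrder byStart) (sort-↗ us)

totalLength-sort : ∀ us → totalLength (sort us) ≡ totalLength us
totalLength-sort us = sum-↭ (map⁺ proj₂ (sort-↭ us))

Gap : List Interval → ℚ → Set
Gap us x = ∃[ τ ] x ℚ.≤ τ × τ ℚ.≤ x ℚ.+ fromℕ (totalLength us) × All (¬_ ∘ Covers τ) us

-- Sweep from `x`: either the first interval starts after `x`, and with it all the others, or it
-- starts by `x` and is over at `x + t`, where the sweep goes on with the length that remains.
sorted-gap : ∀ us → Sorted us → ∀ x → Gap us x
sorted-gap [] _ x = x , ℚ.≤-refl , p≤p+fromℕ x 0 , []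
sorted-gap (u@(s , t) ∷ us) (s≤ ∷ ord) x = case s ℚ.≤? x of λ where
  (no s≰x) → x , ℚ.≤-refl , p≤p+fromℕ x (totalLength (u ∷ us))
    , (λ (s≤x , _) → s≰x s≤x)
    ∷ All.map (λ s≤s′ (s′≤x , _) → s≰x (ℚ.≤-trans s≤s′ s′≤x)) s≤
  (yes s≤x) →
    let τ , x+t≤τ , τ≤ , free = sorted-gap us ord (x ℚ.+ fromℕ t) in
    τ , ℚ.≤-trans (p≤p+fromℕ x t) x+t≤τ
    , subst (τ ℚ.≤_) (trans (ℚ.+-assoc x _ _) (cong (x ℚ.+_) (sym (fromℕ-+ t _)))) τ≤
    , (λ (_ , τ<) → ℚ.<-irrefl refl
        (ℚ.<-≤-trans τ< (ℚ.≤-trans (ℚ.+-monoˡ-≤ (fromℕ t) s≤x) x+t≤τ)))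
    ∷ free

gap : ∀ us x → Gap us x
gap us x =
  let τ , x≤τ , τ≤ , free = sorted-gap (sort us) (sort-sorted us) x in
  τ , x≤τ
  , subst (λ l → τ ℚ.≤ x ℚ.+ fromℕ l) (totalLength-sort us) τ≤
  , All-resp-↭ (sort-↭ us) free

Within : ℚ → Interval → Set
Within D u = 0 < proj₂ u × end u ℚ.≤ D

p<p+fromℕ : ∀ p {k} → 0 < k → p ℚ.< p ℚ.+ fromℕ k
p<p+fromℕ p {k} 0<k = subst (ℚ._< p ℚ.+ fromℕ k) (ℚ.+-identityʳ p) (ℚ.+-monoʳ-< p (fromℕ-mono-< {0} {k} 0<k))

-- The first interval ends no earlier than `x + t`, and disjointness pushes all later starts past
-- that end, so the induction continues from the end instead of `x`.
sorted-packing : ∀ {D} us → Sorted us → AllPairs Disjoint us → All (Within D) us →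
  ∀ {x} → x ℚ.≤ D → All (λ u → x ℚ.≤ proj₁ u) us → x ℚ.+ fromℕ (totalLength us) ℚ.≤ D
sorted-packing [] _ _ _ {x} x≤D _ = subst (ℚ._≤ _) (sym (ℚ.+-identityʳ x)) x≤D
sorted-packing {D} (u@(s , t) ∷ us) (s≤ ∷ ord) (dis ∷ diss) ((0<t , e≤D) ∷ win) {x} x≤D (x≤s ∷ x≤) =
  subst (ℚ._≤ D) (trans (ℚ.+-assoc x _ _) (cong (x ℚ.+_) (sym (fromℕ-+ t _))))
    (ℚ.≤-trans (ℚ.+-monoˡ-≤ (fromℕ (totalLength us)) (ℚ.+-monoˡ-≤ (fromℕ t) x≤s))
      (sorted-packing us ord diss win e≤D (All.zipWith after (s≤ , All.zip (dis , win)))))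
  where
  after : ∀ {v} → s ℚ.≤ proj₁ v × (Disjoint u v × Within D v) → end u ℚ.≤ proj₁ v
  after {s′ , t′} (s≤s′ , dis′ , 0<t′ , _) =
    -- If `v` started before `u` ended, the start of `v` would lie in both intervals; positive
    -- length puts it into `v`.
    ℚ.≮⇒≥ λ s′<e → dis′ s′ ((s≤s′ , s′<e) , (ℚ.≤-refl , p<p+fromℕ s′ 0<t′))

packing : ∀ {D} us → AllPairs Disjoint us → All (Within D) us → 0ℚ ℚ.≤ D →
  All (λ u → 0ℚ ℚ.≤ proj₁ u) us → fromℕ (totalLength us) ℚ.≤ D
packing {D} us dis win 0≤D 0≤ =
  subst (ℚ._≤ D) (trans (ℚ.+-identityˡ _) (cong fromℕ (totalLength-sort us)))
    (sorted-packing (sort us) (sort-sorted us)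
      (PermSetoid.AllPairs-resp-↭ (setoid Interval) (λ dis τ (cv , cu) → dis τ (cu , cv))
        ((λ { refl → id }) , (λ { refl → id })) (↭⇒↭ₛ us↭) dis)
      (All-resp-↭ us↭ win) 0≤D (All-resp-↭ us↭ 0≤))
  where us↭ = ↭-sym (sort-↭ us)

-- Selections of jobs

m+[n∸m]≡m⊔n : ∀ m n → m + (n ∸ m) ≡ m ⊔ n
m+[n∸m]≡m⊔n zero    n       = refl
m+[n∸m]≡m⊔n (suc m) zero    = cong suc (+-identityʳ m)
m+[n∸m]≡m⊔n (suc m) (suc n) = cong suc (m+[n∸m]≡m⊔n m n)

m∸[m∸n]≡m⊓n : ∀ m n → m ∸ (m ∸ n) ≡ m ⊓ n
m∸[m∸n]≡m⊓n m n = case ≤-total n m of λ where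
  (inj₁ n≤m) → trans (m∸[m∸n]≡n n≤m) (sym (m≥n⇒m⊓n≡n n≤m))
  (inj₂ m≤n) → trans (cong (m ∸_) (m≤n⇒m∸n≡0 m≤n)) (sym (m≤n⇒m⊓n≡m m≤n))

m⊓n≤o⇒m≤o⊎n≤o : ∀ m n {o} → m ⊓ n ≤ o → m ≤ o ⊎ n ≤ o
m⊓n≤o⇒m≤o⊎n≤o m n le = case ⊓-sel m n of λ where
  (inj₁ e) → inj₁ (subst (_≤ _) e le)
  (inj₂ e) → inj₂ (subst (_≤ _) e le)

least : {P : ℕ → Set} → Decidable P → ∀ m → P m →
  ∃[ k ] k ≤ m × P k × (∀ l → l < k → ¬ P l)
least {P} P? m Pm = search m 0 (+-identityʳ m) (λ _ ())
  where
  search : ∀ i k → i + k ≡ m → (∀ l → l < k → ¬ P l) →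
    ∃[ k ] k ≤ m × P k × (∀ l → l < k → ¬ P l)
  search zero    k refl below = k , ≤-refl , Pm , below
  search (suc i) k eq   below with P? k
  ... | yes Pk = k , subst (k ≤_) eq (m≤n+m k (suc i)) , Pk , below
  ... | no ¬Pk = search i (suc k) (trans (+-suc i k) eq) λ l l<1+k →
    case m≤n⇒m<n∨m≡n (≤-pred l<1+k) of λ where
      (inj₁ l<k)  → below l l<k
      (inj₂ refl) → ¬Pk

-- Job lists are in decreasing order of deadlines, the last job first.
module Jobs (t d : ℕ → ℕ) where

  crit : ℕ → ℕ
  crit j = d j ∸ t j

  Relevant : ℕ → Set
  Relevant j = 0 < t j × t j ≤ d j

  -- L without the skipped jobs, all critical before v, can be processed in
  -- order of deadlines during [ 0 , x ).
  data Selection (v : ℕ) : List ℕ → ℕ → Set where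
    done : Selection v [] 0
    skip : ∀ {j L x} → crit j < v → Selection v L x → Selection v (j ∷ L) x
    take : ∀ {j L x} → x + t j ≤ d j → Selection v L x → Selection v (j ∷ L) (x + t j)

  selection-mono : ∀ {v v′ L x} → v ≤ v′ → Selection v L x → Selection v′ L x
  selection-mono v≤v′ done       = done
  selection-mono v≤v′ (skip c S) = skip (≤-trans c v≤v′) (selection-mono v≤v′ S)
  selection-mono v≤v′ (take e S) = take e (selection-mono v≤v′ S)

  selection-bound : ∀ {K v L x} → All (λ j → d j ≤ K) L → Selection v L x → x ≤ K
  selection-bound _         done       = z≤n
  selection-bound (_ ∷ d≤K) (skip _ S) = selection-bound d≤K S
  selection-bound (d≤K ∷ _) (take e _) = ≤-trans e d≤K

  -- A job rejected at total `T` satisfies `d j < T + t j`, so it is critical before `T`, and later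
  -- additions only raise the threshold. This provides a qualifying diagonal entry and thereby
  -- bounds the search for the least one.
  greedy : ∀ L → All Relevant L → ∃[ T ] Selection T L T
  greedy []      []                 = 0 , done
  greedy (j ∷ L) ((_ , t≤d) ∷ rel) with greedy L rel
  ... | T , S with T + t j ≤? d j
  ...   | yes fits = T + t j , take fits (selection-mono (m≤m+n T (t j)) S)
  ...   | no late  = T , skip (m<n+o⇒m∸n<o (d j) (t j) ⦃ >-nonZero pos ⦄ (subst (d j <_) (+-comm T (t j)) (≰⇒> late))) S
    where
    -- At total 0 a relevant job always fits, so a rejection forces `T` to be positive, as the
    -- truncated subtraction in `crit` demands.
    pos : 0 < T
    pos = n≢0⇒n>0 λ { refl → late t≤d }

  -- The least v with Selection v L x, for values below ∞; maximum and minimum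
  -- are spelled with the machine's arithmetic.
  module Table (∞ : ℕ) where

    -- A sum of truncated differences vanishes exactly when all its inequalities hold; here
    -- `t j ≤ x` and `x ≤ d j`, the condition for `j` to finish at `x`.
    guard : ℕ → ℕ → ℕ
    guard j x = (t j ∸ x) + (x ∸ d j)

    skipValue : ℕ → ℕ → ℕ
    skipValue j m = m + (suc (crit j) ∸ m)

    cell : List ℕ → ℕ → ℕ
    cell []      zero    = 0
    cell []      (suc _) = ∞
    cell (j ∷ L) x       = if guard j x ≡ᵇ 0
      then skipValue j (cell L x) ∸ (skipValue j (cell L x) ∸ cell L (x ∸ t j))
      else skipValue j (cell L x)

    skipValue≤ : ∀ {j m v} → crit j < v → m ≤ v → skipValue j m ≤ v
    skipValue≤ {j} {m} c m≤v = subst (_≤ _) (sym (m+[n∸m]≡m⊔n m (suc (crit j)))) (⊔-lub m≤v c)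

    skipValue≤⁻¹ : ∀ {j m v} → skipValue j m ≤ v → crit j < v × m ≤ v
    skipValue≤⁻¹ {j} {m} {v} h = m⊔n≤o⇒n≤o m _ h′ , m⊔n≤o⇒m≤o m (suc (crit j)) h′
      where h′ = subst (_≤ v) (m+[n∸m]≡m⊔n m (suc (crit j))) h

    cell≤skip : ∀ j L x → cell (j ∷ L) x ≤ skipValue j (cell L x)
    cell≤skip j L x with guard j x ≡ᵇ 0
    ... | true  = m∸n≤m (skipValue j (cell L x)) (skipValue j (cell L x) ∸ cell L (x ∸ t j))
    ... | false = ≤-refl

    cell≤take : ∀ j L x → guard j x ≡ 0 → cell (j ∷ L) x ≤ cell L (x ∸ t j)
    cell≤take j L x g rewrite g =
      subst (_≤ cell L (x ∸ t j)) (sym (m∸[m∸n]≡m⊓n (skipValue j (cell L x)) (cell L (x ∸ t j))))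
        (m⊓n≤n (skipValue j (cell L x)) (cell L (x ∸ t j)))

    -- The recurrence read backwards: a bounded entry names the alternative responsible for it, and
    -- the reconstruction follows that alternative.
    cell-cases : ∀ {v} j L x → cell (j ∷ L) x ≤ v →
      (guard j x ≡ 0 × cell L (x ∸ t j) ≤ v) ⊎ (crit j < v × cell L x ≤ v)
    cell-cases {v} j L x h with guard j x
    ... | suc _ = inj₂ (skipValue≤⁻¹ h)
    ... | zero with subst (_≤ v) (m∸[m∸n]≡m⊓n (skipValue j (cell L x)) (cell L (x ∸ t j))) h
    ...   | h′ = case m⊓n≤o⇒m≤o⊎n≤o (skipValue j (cell L x)) (cell L (x ∸ t j)) h′ of λ where
      (inj₁ s≤v) → inj₂ (skipValue≤⁻¹ s≤v)
      (inj₂ t≤v) → inj₁ (refl , t≤v)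

    -- This half yields optimality. The other half, that a small entry comes from an actual choice
    -- of jobs, is obtained as a `Plan` by the reconstruction loop.
    selection⇒cell≤ : ∀ {v L x} → Selection v L x → cell L x ≤ v
    selection⇒cell≤ done = z≤n
    selection⇒cell≤ (skip {j} {L} {x} c S) =
      ≤-trans (cell≤skip j L x) (skipValue≤ c (selection⇒cell≤ S))
    selection⇒cell≤ (take {j} {L} {x} e S) =
      ≤-trans (cell≤take j L (x + t j) (cong₂ _+_ (m≤n⇒m∸n≡0 (m≤n+m (t j) x)) (m≤n⇒m∸n≡0 e)))
        (subst (λ y → cell L y ≤ _) (sym (m+n∸n≡m x (t j))) (selection⇒cell≤ S))

  module _ (executed start : ℕ → ℕ) (v : ℕ) where

    -- A selection read off from array contents: a taken job starts at the total length of the taken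
    -- jobs in the tail, that is, directly after those that precede it in deadline order.
    data Plan : List ℕ → ℕ → Set where
      done : Plan [] 0
      skip : ∀ {j L x} → crit j < v → executed j ≡ 0 → Plan L x → Plan (j ∷ L) x
      take : ∀ {j L x} → x + t j ≤ d j → executed j ≡ 1 → start j ≡ x →
        Plan L x → Plan (j ∷ L) (x + t j)

  module _ {executed start : ℕ → ℕ} {v : ℕ} where

    plan-deadline : ∀ {L x k} → Plan executed start v L x → k ∈ L → executed k ≢ 0 →
      start k + t k ≤ d k
    plan-deadline (skip _ e P)       (here refl) k≢0 = contradiction e k≢0
    plan-deadline (take fits _ s P)  (here refl) k≢0 = subst (λ y → y + _ ≤ _) (sym s) fits
    plan-deadline (skip _ _ P)       (there k∈L) k≢0 = plan-deadline P k∈L k≢0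
    plan-deadline (take _ _ _ P)     (there k∈L) k≢0 = plan-deadline P k∈L k≢0

    plan-end : ∀ {L x k} → Plan executed start v L x → k ∈ L → executed k ≢ 0 → start k + t k ≤ x
    plan-end (skip _ e P)               (here refl) k≢0 = contradiction e k≢0
    plan-end (take _ _ s P)             (here refl) k≢0 = ≤-reflexive (cong (_+ _) s)
    plan-end (skip _ _ P)               (there k∈L) k≢0 = plan-end P k∈L k≢0
    plan-end (take {j} {x = x} _ _ _ P) (there k∈L) k≢0 = ≤-trans (plan-end P k∈L k≢0) (m≤m+n x (t j))

    plan-skipped : ∀ {L x k} → Plan executed start v L x → k ∈ L → executed k ≡ 0 → crit k < v
    plan-skipped (skip c _ _)   (here refl) _   = c
    plan-skipped (take _ e _ _) (here refl) k≡0 = contradiction (trans (sym k≡0) e) λ ()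
    plan-skipped (skip _ _ P)   (there k∈L) k≡0 = plan-skipped P k∈L k≡0
    plan-skipped (take _ _ _ P) (there k∈L) k≡0 = plan-skipped P k∈L k≡0

    -- Of two taken jobs, the one nearer the head starts at the total of its tail, by which time
    -- everything in the tail has ended.
    plan-apart : ∀ {L x i k} → Plan executed start v L x → i ∈ L → k ∈ L → i ≢ k →
      executed i ≢ 0 → executed k ≢ 0 →
      start i + t i ≤ start k ⊎ start k + t k ≤ start i
    plan-apart _ (here refl) (here refl) i≢k _ _ = contradiction refl i≢k
    plan-apart (skip _ e _) (here refl) (there _) _ i≢0 _ = contradiction e i≢0
    plan-apart (skip _ e _) (there _) (here refl) _ _ k≢0 = contradiction e k≢0
    plan-apart (take _ _ s P) (here refl) (there k∈L) _ _ k≢0 =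
      inj₂ (subst (_ ≤_) (sym s) (plan-end P k∈L k≢0))
    plan-apart (take _ _ s P) (there i∈L) (here refl) _ i≢0 _ =
      inj₁ (subst (_ ≤_) (sym s) (plan-end P i∈L i≢0))
    plan-apart (skip _ _ P)   (there i∈L) (there k∈L) = plan-apart P i∈L k∈L
    plan-apart (take _ _ _ P) (there i∈L) (there k∈L) = plan-apart P i∈L k∈L

    plan-sum : ∀ {L x} → Plan executed start v L x →
      sum (map (λ j → if executed j ≡ᵇ 0 then 0 else t j) L) ≡ x
    plan-sum done = refl
    plan-sum (skip _ e P) rewrite e = plan-sum P
    plan-sum (take {j} {x = x} _ e _ P) rewrite e = trans (cong (t j +_) (plan-sum P)) (+-comm (t j) x)

  -- With threshold 0 no job can be skipped, and taking a relevant one would make the total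
  -- positive.
  plan-empty : ∀ {executed start L x} → All Relevant L → x ≡ 0 → Plan executed start 0 L x → L ≡ []
  plan-empty _                 _  done                  = refl
  plan-empty ((0<t , _) ∷ _)   eq (take {x = x} _ _ _ _) = contradiction (m+n≡0⇒n≡0 x eq) (>⇒≢ 0<t)

  -- The order reached after scanning the jobs below n for every deadline
  -- below D, and those below i for the deadline D.
  record Scanned (n D i : ℕ) (L : List ℕ) : Set where
    field
      sorted   : AllPairs (λ j k → d k ≤ d j × j ≢ k) L
      sound    : All (λ j → Relevant j × j < n × (d j < D ⊎ (d j ≡ D × j < i))) L
      complete : ∀ j → Relevant j → j < n → d j < D ⊎ (d j ≡ D × j < i) → j ∈ L

  open Scanned

  scanned-start : ∀ {n} → Scanned n 0 0 []
  scanned-start .sorted = []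
  scanned-start .sound = []
  scanned-start .complete _ _ _ (inj₁ ())
  scanned-start .complete _ _ _ (inj₂ (_ , ()))

  scanned-hit : ∀ {n D i L} → Relevant i → i < n → d i ≡ D → Scanned n D i L → Scanned n D (suc i) (i ∷ L)
  scanned-hit {D = D} {i} rel i<n di≡D S = λ where
      .sorted → All.map new (sound S) ∷ sorted S
      .sound → (rel , i<n , inj₂ (di≡D , ≤-refl)) ∷ All.map older (sound S)
      .complete j rj j<n (inj₁ lt) → there (complete S j rj j<n (inj₁ lt))
      .complete j rj j<n (inj₂ (eq , j≤i)) → case m≤n⇒m<n∨m≡n (≤-pred j≤i) of λ where
        (inj₁ j<i)  → there (complete S j rj j<n (inj₂ (eq , j<i)))
        (inj₂ refl) → here refl
    where
    older : ∀ {n k} → Relevant k × k < n × (d k < D ⊎ (d k ≡ D × k < i)) →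
      Relevant k × k < n × (d k < D ⊎ (d k ≡ D × k < suc i))
    older (rk , k<n , inj₁ lt)         = rk , k<n , inj₁ lt
    older (rk , k<n , inj₂ (eq , k<i)) = rk , k<n , inj₂ (eq , m≤n⇒m≤1+n k<i)
    new : ∀ {n k} → Relevant k × k < n × (d k < D ⊎ (d k ≡ D × k < i)) → d k ≤ d i × i ≢ k
    new (_ , _ , inj₁ lt)         = subst (_ ≤_) (sym di≡D) (<⇒≤ lt) , λ { refl → <-irrefl di≡D lt }
    new (_ , _ , inj₂ (eq , k<i)) = ≤-reflexive (trans eq (sym di≡D)) , λ { refl → <-irrefl refl k<i }

  scanned-miss : ∀ {n D i L} → ¬ (Relevant i × d i ≡ D) → Scanned n D i L → Scanned n D (suc i) L
  scanned-miss ¬hit S = λ where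
    .sorted → sorted S
    .sound → All.map (λ where
      (rk , k<n , inj₁ lt)         → rk , k<n , inj₁ lt
      (rk , k<n , inj₂ (eq , k<i)) → rk , k<n , inj₂ (eq , m≤n⇒m≤1+n k<i)) (sound S)
    .complete j rj j<n (inj₁ lt) → complete S j rj j<n (inj₁ lt)
    .complete j rj j<n (inj₂ (eq , j≤i)) → case m≤n⇒m<n∨m≡n (≤-pred j≤i) of λ where
      (inj₁ j<i)  → complete S j rj j<n (inj₂ (eq , j<i))
      (inj₂ refl) → contradiction (rj , eq) ¬hit

  scanned-next : ∀ {n D L} → Scanned n D n L → Scanned n (suc D) 0 L
  scanned-next S = λ where
    .sorted → sorted S
    .sound → All.map (λ where
      (rk , k<n , inj₁ lt)       → rk , k<n , inj₁ (m≤n⇒m≤1+n lt)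
      (rk , k<n , inj₂ (eq , _)) → rk , k<n , inj₁ (≤-reflexive (cong suc eq))) (sound S)
    .complete j rj j<n (inj₁ lt) → complete S j rj j<n (case m≤n⇒m<n∨m≡n (≤-pred lt) of λ where
      (inj₁ lt′) → inj₁ lt′
      (inj₂ eq)  → inj₂ (eq , j<n))

-- The program

open State

update-same : ∀ {A : Set} (f : ℕ → A) k v → update f k v k ≡ v
update-same f k v = cong (if_then v else f k) (dec-true (k ≟ k) refl)

update-other : ∀ {A : Set} (f : ℕ → A) {k l} v → l ≢ k → update f k v l ≡ f l
update-other f {k} {l} v l≢k = cong (if_then v else f l) (dec-false (l ≟ k) l≢k)

update-below : ∀ {A : Set} {P : ℕ → A → Set} {f : ℕ → A} {k v} → P k v →
  (∀ l → l < k → P l (f l)) → ∀ l → l < suc k → P l (update f k v l)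
update-below {P = P} {f} {k} {v} Pv below l l<1+k = case m≤n⇒m<n∨m≡n (≤-pred l<1+k) of λ where
  (inj₁ l<k)  → subst (P l) (sym (update-other f v (<⇒≢ l<k))) (below l l<k)
  (inj₂ refl) → subst (P l) (sym (update-same f k v)) Pv

-- Reversed, so that writing the next array cell is a cons and an array filled by increasing
-- deadline reads as a list by decreasing deadline.
prefix : (ℕ → ℕ) → ℕ → List ℕ
prefix f zero    = []
prefix f (suc r) = f r ∷ prefix f r

prefix-update : ∀ f v {k} r → r ≤ k → prefix (update f k v) r ≡ prefix f r
prefix-update f v zero    _   = refl
prefix-update f v (suc r) r<k = cong₂ _∷_ (update-other f v (<⇒≢ r<k)) (prefix-update f v r (<⇒≤ r<k))

prefix-snoc : ∀ f v r → prefix (update f r v) (suc r) ≡ v ∷ prefix f r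
prefix-snoc f v r = cong₂ _∷_ (update-same f r v) (prefix-update f v r ≤-refl)

prefix-∈ : ∀ f {a r} → a < r → f a ∈ prefix f r
prefix-∈ f {a} {suc r} a≤r = case m≤n⇒m<n∨m≡n (≤-pred a≤r) of λ where
  (inj₁ a<r)  → there (prefix-∈ f a<r)
  (inj₂ refl) → here refl

prefix-≢ : ∀ f {a b r} → AllPairs _≢_ (prefix f r) → a < b → b < r → f b ≢ f a
prefix-≢ f {a} {b} {suc r} (new ∷ uniq) a<b b≤r = case m≤n⇒m<n∨m≡n (≤-pred b≤r) of λ where
  (inj₁ b<r)  → prefix-≢ f uniq a<b b<r
  (inj₂ refl) → All.lookup new (prefix-∈ f a<b)

-- Pigeonhole; it bounds the number of table rows by the number of jobs in the time analysis.
prefix-length : ∀ f {n} r → AllPairs _≢_ (prefix f r) → All (_< n) (prefix f r) → r ≤ n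
prefix-length f {n} r uniq below = injective⇒≤ {f = g} λ {a} {b} ga≡gb → toℕ-injective (inj a b (fromℕ<-injective _ _ _ _ ga≡gb))
  where
  f< : ∀ (i : Fin r) → f (toℕ i) < n
  f< i = All.lookup below (prefix-∈ f (toℕ<n i))
  g : Fin r → Fin n
  g i = fromℕ< (f< i)
  inj : ∀ (a b : Fin r) → f (toℕ a) ≡ f (toℕ b) → toℕ a ≡ toℕ b
  inj a b eq with <-cmp (toℕ a) (toℕ b)
  ... | tri< a<b _ _ = contradiction (sym eq) (prefix-≢ f uniq a<b (toℕ<n b))
  ... | tri≈ _ e _   = e
  ... | tri> _ _ b<a = contradiction eq (prefix-≢ f uniq b<a (toℕ<n a))

-- Terminating runs with a postcondition and a time budget

Exec : Program → State → (State → Set) → ℕ → Set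
Exec p s Q b = Σ[ s′ ∈ State ] Σ[ k ∈ ℕ ] Run p s s′ k × Q s′ × k ≤ b

weaken : ∀ {p s b b′} {Q Q′ : State → Set} → (∀ {s′} → Q s′ → Q′ s′) → b ≤ b′ → Exec p s Q b → Exec p s Q′ b′
weaken Q⇒Q′ b≤b′ (s′ , k , run , q , k≤b) = s′ , k , run , Q⇒Q′ q , ≤-trans k≤b b≤b′

-- The cost of a loop-free run is a closed numeral, so the implicit budget check evaluates to the
-- unit type and is filled in automatically.
straight : ∀ b {p s s′ k} {Q : State → Set} → Run p s s′ k → Q s′ → {Bool.T (k ≤ᵇ b)} → Exec p s Q b
straight b {k = k} run q {k≤b} = _ , k , run , q , ≤ᵇ⇒≤ k b k≤b

infixr 2 _andThen_

_andThen_ : ∀ {p q s b c} {Q R : State → Set} → Exec p s Q b → (∀ s′ → Q s′ → Exec q s′ R c) → Exec (p ⨾ q) s R (b + c)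
(s′ , k , run , q , k≤b) andThen next with next s′ q
... | s″ , l , run′ , r , l≤c = s″ , k + l , seq run run′ , r , +-mono-≤ k≤b l≤c

-- For loops whose number of iterations `N` is known beforehand. The factor `suc N` leaves room for
-- the last, failing test.
exec-loop : ∀ {e p} (Inv : ℕ → State → Set) (N c : ℕ) →
  (∀ {i s} → i < N → Inv i s → eval s e ≢ 0) →
  (∀ {s} → Inv N s → eval s e ≡ 0) →
  (∀ {i s} → i < N → Inv i s → Exec p s (Inv (suc i)) c) →
  ∀ {s} → Inv 0 s → Exec (while e loop p) s (Inv N) (suc N * (suc (cost e) + c))
exec-loop {e} {p} Inv N c continue stop body = go N 0 (+-identityʳ N)
  where
  go : ∀ m i → m + i ≡ N → ∀ {s} → Inv i s → Exec (while e loop p) s (Inv N) (suc m * (suc (cost e) + c))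
  go zero i refl inv =
    _ , _ , while-false (stop inv) , inv , ≤-trans (m≤m+n (suc (cost e)) c) (m≤m+n (suc (cost e) + c) 0)
  go (suc m) i eq inv with body i<N inv
    where i<N = subst (i <_) eq (s≤s (m≤n+m i m))
  ... | s′ , k , run , inv′ , k≤c with go m (suc i) (trans (+-suc m i) eq) inv′
  ... | s″ , l , run′ , inv″ , l≤ = s″ , _ , while-true (continue i<N inv) run run′ , inv″
    , subst (suc (cost e) + (k + l) ≤_) (sym (+-assoc (suc (cost e)) c _))
        (+-monoʳ-≤ (suc (cost e)) (+-mono-≤ k≤c l≤))
    where i<N = subst (i <_) eq (s≤s (m≤n+m i m))

-- The algorithm as a program

rN rK rZ rI rD rR rRow rX rBase rW rT rJob rC rM : ℕ
rN = 0 ; rK = 1 ; rZ = 2 ; rI = 3 ; rD = 4 ; rR = 5 ; rRow = 6 ; rX = 7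
rBase = 8 ; rW = 9 ; rT = 10 ; rJob = 11 ; rC = 12 ; rM = 13

aT aD aExec aStart aOrd aTab : ℕ
aT = 0 ; aD = 2 ; aExec = 3 ; aStart = 4 ; aOrd = 5 ; aTab = 6

-- With the constant on the left the new value is definitionally a `suc`, so invariants advance by
-- computation. For the same reason table addresses put `rW` before `rBase`: `suc K + r * suc K` is
-- what `suc r * suc K` unfolds to.
increment : ℕ → Program
increment x = x ≔ const 1 ⊕ reg x

preprocessBody preprocess : Program
preprocessBody =
  rK ≔ reg rK ⊕ (aD [ reg rI ] ⊖ reg rK) ⨾
  (ifnz aT [ reg rI ] then aExec [ reg rI ]≔ const 0
   -- Zero-length jobs are provisionally placed at time 0; `rZ` remembers that there is one, for the
   -- final verdict.
   else (rZ ≔ const 1 ⨾ aExec [ reg rI ]≔ const 1 ⨾ aStart [ reg rI ]≔ const 0)) ⨾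
  increment rI
preprocess =
  (rI ≔ const 0 ⨾ rK ≔ const 0 ⨾ rZ ≔ const 0) ⨾
  while reg rN ⊖ reg rI loop preprocessBody

-- Zero exactly for the relevant jobs due at the deadline value of the current sweep.
misses : Expr
misses = ((aD [ reg rI ] ⊖ reg rD) ⊕ (reg rD ⊖ aD [ reg rI ]))
       ⊕ ((const 1 ⊖ aT [ reg rI ]) ⊕ (aT [ reg rI ] ⊖ aD [ reg rI ]))

-- Sorting by one scan of all jobs per deadline value costs on the order of `K * n`. A comparison
-- sort, at `n log n`, would exceed the claimed bound when `K` is small.
scanBody scanRow order : Program
scanBody =
  (ifnz misses then skip else (aOrd [ reg rR ]≔ reg rI ⨾ increment rR)) ⨾
  increment rI
scanRow = rI ≔ const 0 ⨾ (while reg rN ⊖ reg rI loop scanBody) ⨾ increment rD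
order =
  -- `K + 1` serves three purposes: the number of deadline values swept, the width of a table row,
  -- and the sentinel for infinity.
  (rW ≔ const 1 ⊕ reg rK ⨾ rD ≔ const 0 ⨾ rR ≔ const 0) ⨾
  while reg rW ⊖ reg rD loop scanRow

infeasible : Expr
infeasible = (aT [ reg rJob ] ⊖ reg rX) ⊕ (reg rX ⊖ aD [ reg rJob ])

-- The table is stored row by row in a single array, with the row offset kept in `rBase` and moved
-- by additions and subtractions of `rW`. Truncation keeps the index of `taken` inside the row even
-- if the job is longer than `x`.
above taken : Expr
above = aTab [ reg rBase ⊕ reg rX ]
taken = aTab [ reg rBase ⊕ (reg rX ⊖ aT [ reg rJob ]) ]

firstRowBody firstRow cellBody rowBody rows : Program
firstRowBody = aTab [ reg rX ]≔ reg rW ⨾ increment rX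
firstRow =
  (aTab [ const 0 ]≔ const 0 ⨾ rX ≔ const 1) ⨾
  while reg rW ⊖ reg rX loop firstRowBody
cellBody =
  rM ≔ above ⊕ (reg rC ⊖ above) ⨾
  (ifnz infeasible then aTab [ (reg rW ⊕ reg rBase) ⊕ reg rX ]≔ reg rM
   else (aTab [ (reg rW ⊕ reg rBase) ⊕ reg rX ]≔ reg rM ⊖ (reg rM ⊖ taken))) ⨾
  increment rX
rowBody =
  (rJob ≔ aOrd [ reg rRow ] ⨾ rC ≔ const 1 ⊕ (aD [ reg rJob ] ⊖ aT [ reg rJob ]) ⨾ rX ≔ const 0) ⨾
  (while reg rW ⊖ reg rX loop cellBody) ⨾
  rBase ≔ reg rW ⊕ reg rBase ⨾ increment rRow
rows =
  (rRow ≔ const 0 ⨾ rBase ≔ const 0) ⨾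
  while reg rR ⊖ reg rRow loop rowBody

search : Program
search = rT ≔ const 0 ⨾ while aTab [ reg rBase ⊕ reg rT ] ⊖ reg rT loop increment rT

-- No choices are stored while filling the table. A job is taken whenever it can finish at the
-- remaining length and the preceding row stays within `T` at the length left over; otherwise
-- skipping must be possible.
rebuildBody rebuildLoop rebuild finish : Program
rebuildBody =
  rRow ≔ reg rRow ⊖ const 1 ⨾
  rBase ≔ reg rBase ⊖ reg rW ⨾
  rJob ≔ aOrd [ reg rRow ] ⨾
  (ifnz infeasible ⊕ (taken ⊖ reg rT) then skip
   -- Once the job is subtracted, `rX` is the total of the jobs before it, hence its start time.
   else (rX ≔ reg rX ⊖ aT [ reg rJob ] ⨾ aExec [ reg rJob ]≔ const 1 ⨾ aStart [ reg rJob ]≔ reg rX))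
rebuildLoop = while reg rRow loop rebuildBody
rebuild = rX ≔ reg rT ⨾ rebuildLoop
-- If a zero-length job exists, `T` itself is the verdict: it is 0 only when there is no relevant
-- job, and then nothing can occupy the processor at time 0 while the zero-length job is executable.
finish = ifnz reg rZ then rN ≔ reg rT else (rN ≔ const 1)

program : Program
program = preprocess ⨾ order ⨾ firstRow ⨾ rows ⨾ search ⨾ rebuild ⨾ finish

-- Correctness and running time of the program

module Verify (n : ℕ) (t d : ℕ → ℕ) (Kmax : ℕ) (d≤Kmax : ∀ j → j < n → d j ≤ Kmax) where
  open Jobs t d

  Marked : ℕ → ℕ → ℕ → Set
  Marked j executed start = (t j ≡ 0 × executed ≡ 1 × start ≡ 0) ⊎ (t j ≢ 0 × executed ≡ 0)

  -- The interface to the scheduling argument, free of machine states. Minimality is claimed against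
  -- selections only; that feasible schedules give rise to selections is a separate matter.
  record Solved (reported : ℕ) (executed start : ℕ → ℕ) : Set where
    field
      L        : List ℕ
      T        : ℕ
      sorted   : AllPairs (λ j k → d k ≤ d j × j ≢ k) L
      sound    : All (λ j → Relevant j × j < n) L
      complete : ∀ j → Relevant j → j < n → j ∈ L
      plan     : Plan executed start T L T
      minimal  : ∀ x → Selection x L x → T ≤ x
      marks    : ∀ j → j < n → j ∉ L → Marked j (executed j) (start j)
      success  : reported ≢ 0 → T ≢ 0 ⊎ (∀ j → j < n → t j ≢ 0)
      failure  : reported ≡ 0 → T ≡ 0 × ∃[ j ] j < n × t j ≡ 0

  SolvedAt : State → Set
  SolvedAt s = Solved (regs s rN) (arrs s aExec) (arrs s aStart)

  -- The common unit of all time bounds: a loop over `0 , … , K` makes at most `Kmax + 2` tests and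
  -- a loop over jobs at most `n + 1`, the failing one included. `Bounded` then only adds up
  -- constant multiples of this unit.
  U : ℕ
  U = suc (suc Kmax) * suc n

  record Bounded (x c : ℕ) : Set where
    constructor bounded
    field bound : x ≤ U * c
  open Bounded

  bounded-const : ∀ c → Bounded c c
  bounded-const c = bounded (m≤n*m c U)

  bounded-+ : ∀ {x y a b} → Bounded x a → Bounded y b → Bounded (x + y) (a + b)
  bounded-+ {a = a} {b} (bounded x≤) (bounded y≤) =
    bounded (≤-trans (+-mono-≤ x≤ y≤) (≤-reflexive (sym (*-distribˡ-+ U a b))))

  bounded-deadlines : ∀ {x y} c → x ≤ suc (suc Kmax) → y ≤ suc n * c → Bounded (x * y) c
  bounded-deadlines c x≤ y≤ =
    bounded (≤-trans (*-mono-≤ x≤ y≤) (≤-reflexive (sym (*-assoc (suc (suc Kmax)) (suc n) c))))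

  bounded-jobs : ∀ {x y} c → x ≤ suc n → y ≤ suc (suc Kmax) * c → Bounded (x * y) c
  bounded-jobs c x≤ y≤ = bounded (≤-trans (*-mono-≤ x≤ y≤)
    (≤-reflexive (trans (sym (*-assoc (suc n) (suc (suc Kmax)) c))
      (cong (_* c) (*-comm (suc n) (suc (suc Kmax)))))))

  -- Invariants are stated on the values they mention, so that they transport
  -- definitionally across updates of all other registers and arrays.
  record Preprocessing (i rn ri k z : ℕ) (at ad executed start : ℕ → ℕ) : Set where
    field
      rn≡n     : rn ≡ n
      ri≡i     : ri ≡ i
      at≡t     : at ≡ t
      ad≡d     : ad ≡ d
      d≤k      : ∀ j → j < i → d j ≤ k
      k≤Kmax   : k ≤ Kmax
      allPos   : z ≡ 0 → ∀ j → j < i → t j ≢ 0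
      someZero : z ≢ 0 → ∃[ j ] j < n × t j ≡ 0
      marks    : ∀ j → j < i → Marked j (executed j) (start j)

  PreprocessingAt : ℕ → State → Set
  PreprocessingAt i s = Preprocessing i (regs s rN) (regs s rI) (regs s rK) (regs s rZ)
    (arrs s aT) (arrs s aD) (arrs s aExec) (arrs s aStart)

  below-suc : ∀ {P : ℕ → Set} {i} → P i → (∀ j → j < i → P j) → ∀ j → j < suc i → P j
  below-suc {P} Pi below j j<1+i = case m≤n⇒m<n∨m≡n (≤-pred j<1+i) of λ where
    (inj₁ j<i) → below j j<i
    (inj₂ eq)  → subst P (sym eq) Pi

  step-max : ∀ {i k} → i < n → k ≤ Kmax → (∀ j → j < i → d j ≤ k) →
    k + (d i ∸ k) ≤ Kmax × (∀ j → j < suc i → d j ≤ k + (d i ∸ k))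
  step-max {i} {k} i<n k≤ d≤k =
    subst (_≤ Kmax) (sym (m+[n∸m]≡m⊔n k (d i))) (⊔-lub k≤ (d≤Kmax i i<n)) ,
    below-suc (m≤n+m∸n (d i) k) (λ j j<i → ≤-trans (d≤k j j<i) (m≤m+n k _))

  step-zero : ∀ {i rn ri k z at ad ex st} → i < n → at ri ≡ 0 → Preprocessing i rn ri k z at ad ex st →
    Preprocessing (suc i) rn (suc ri) (k + (ad ri ∸ k)) 1 at ad (update ex ri 1) (update st ri 0)
  step-zero {i} {ex = ex} {st} i<n ti≡0 record { rn≡n = refl ; ri≡i = refl ; at≡t = refl ; ad≡d = refl
      ; d≤k = d≤k ; k≤Kmax = k≤ ; marks = marks } = record
    { rn≡n = refl ; ri≡i = refl ; at≡t = refl ; ad≡d = refl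
    ; d≤k = proj₂ (step-max i<n k≤ d≤k)
    ; k≤Kmax = proj₁ (step-max i<n k≤ d≤k)
    ; allPos = λ ()
    ; someZero = λ _ → i , i<n , ti≡0
    ; marks = below-suc
        (inj₁ (ti≡0 , update-same ex i 1 , update-same st i 0))
        (λ j j<i → subst₂ (Marked j)
          (sym (update-other ex 1 (<⇒≢ j<i))) (sym (update-other st 0 (<⇒≢ j<i))) (marks j j<i))
    }

  step-positive : ∀ {i rn ri k z at ad ex st} → i < n → at ri ≢ 0 → Preprocessing i rn ri k z at ad ex st →
    Preprocessing (suc i) rn (suc ri) (k + (ad ri ∸ k)) z at ad (update ex ri 0) st
  step-positive {i} {ex = ex} {st} i<n ti≢0 record { rn≡n = refl ; ri≡i = refl ; at≡t = refl ; ad≡d = refl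
      ; d≤k = d≤k ; k≤Kmax = k≤ ; allPos = allPos ; someZero = someZero ; marks = marks } = record
    { rn≡n = refl ; ri≡i = refl ; at≡t = refl ; ad≡d = refl
    ; d≤k = proj₂ (step-max i<n k≤ d≤k)
    ; k≤Kmax = proj₁ (step-max i<n k≤ d≤k)
    ; allPos = λ z≡0 → below-suc ti≢0 (allPos z≡0)
    ; someZero = someZero
    ; marks = below-suc
        (inj₂ (ti≢0 , update-same ex i 0))
        (λ j j<i → subst (λ e → Marked j e (st j))
          (sym (update-other ex 0 (<⇒≢ j<i))) (marks j j<i))
    }

  exec-preprocessBody : ∀ {i s} → i < n → PreprocessingAt i s →
    Exec preprocessBody s (PreprocessingAt (suc i)) 24
  exec-preprocessBody {s = s} i<n inv with arrs s aT (regs s rI) ≟ 0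
  ... | yes eq = straight 24 (seq assign (seq (if-false eq (seq assign (seq store store))) assign))
                   (step-zero i<n eq inv)
  ... | no neq = straight 24 (seq assign (seq (if-true neq store) assign)) (step-positive i<n neq inv)

  exec-preprocess : ∀ {s} → regs s rN ≡ n → arrs s aT ≡ t → arrs s aD ≡ d →
    Exec preprocess s (PreprocessingAt n) (6 + suc n * 28)
  exec-preprocess n≡ t≡ d≡ =
    straight 6 (seq assign (seq assign assign))
      (record { rn≡n = n≡ ; ri≡i = refl ; at≡t = t≡ ; ad≡d = d≡ ; d≤k = λ _ () ; k≤Kmax = z≤n
              ; allPos = λ _ _ () ; someZero = λ 0≢0 → contradiction refl 0≢0 ; marks = λ _ () })
    andThen λ _ → exec-loop PreprocessingAt n 24
      (λ i<n inv → subst₂ (λ a b → a ∸ b ≢ 0) (sym (rn≡n inv)) (sym (ri≡i inv)) (m>n⇒m∸n≢0 i<n))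
      (λ inv → m≤n⇒m∸n≡0 (≤-reflexive (trans (rn≡n inv) (sym (ri≡i inv)))))
      exec-preprocessBody
    where open Preprocessing

  module Ordered (K z : ℕ) (executed₀ start₀ : ℕ → ℕ) (d≤K : ∀ j → j < n → d j ≤ K) where
    -- The sentinel exceeds every total in question, as all of them are at most the largest deadline
    -- and so at most `K`.
    open Table (suc K)

    record Static (rn rz rw : ℕ) (at ad : ℕ → ℕ) : Set where
      constructor static
      field
        rn≡n : rn ≡ n
        rz≡z : rz ≡ z
        rw≡w : rw ≡ suc K
        at≡t : at ≡ t
        ad≡d : ad ≡ d

    StaticAt : State → Set
    StaticAt s = Static (regs s rN) (regs s rZ) (regs s rW) (arrs s aT) (arrs s aD)

    Untouched : State → Set
    Untouched s = arrs s aExec ≡ executed₀ × arrs s aStart ≡ start₀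

    record Scanning (D i rd ri rr : ℕ) (ord : ℕ → ℕ) : Set where
      constructor scanning
      field
        rd≡D    : rd ≡ D
        ri≡i    : ri ≡ i
        scanned : Scanned n D i (prefix ord rr)

    ScanningAt : ℕ → ℕ → State → Set
    ScanningAt D i s = StaticAt s × Untouched s
      × Scanning D i (regs s rD) (regs s rI) (regs s rR) (arrs s aOrd)

    missValue : ℕ → ℕ → ℕ
    missValue D i = ((d i ∸ D) + (D ∸ d i)) + ((1 ∸ t i) + (t i ∸ d i))

    hit : ∀ {D i} → missValue D i ≡ 0 → Relevant i × d i ≡ D
    hit {D} {i} eq = (m∸n≡0⇒m≤n {1} (m+n≡0⇒m≡0 (1 ∸ t i) right) , m∸n≡0⇒m≤n (m+n≡0⇒n≡0 (1 ∸ t i) right))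
      , ≤-antisym (m∸n≡0⇒m≤n (m+n≡0⇒m≡0 (d i ∸ D) left)) (m∸n≡0⇒m≤n (m+n≡0⇒n≡0 (d i ∸ D) left))
      where
      left  = m+n≡0⇒m≡0 ((d i ∸ D) + (D ∸ d i)) eq
      right = m+n≡0⇒n≡0 ((d i ∸ D) + (D ∸ d i)) eq

    miss : ∀ {D i} → missValue D i ≢ 0 → ¬ (Relevant i × d i ≡ D)
    miss {i = i} neq ((0<t , t≤d) , refl) = neq (cong₂ _+_
      (cong₂ _+_ (n∸n≡0 (d i)) (n∸n≡0 (d i)))
      (cong₂ _+_ (m≤n⇒m∸n≡0 0<t) (m≤n⇒m∸n≡0 t≤d)))

    step-hit : ∀ {D i rn rz rw at ad rd ri rr ord} → i < n → Static rn rz rw at ad →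
      ((ad ri ∸ rd) + (rd ∸ ad ri)) + ((1 ∸ at ri) + (at ri ∸ ad ri)) ≡ 0 →
      Scanning D i rd ri rr ord → Scanning D (suc i) rd (suc ri) (suc rr) (update ord rr ri)
    step-hit {D} {i} {rr = rr} {ord} i<n (static _ _ _ refl refl) eq (scanning refl refl scanned) =
      scanning refl refl (subst (Scanned n D (suc i)) (sym (prefix-snoc ord i rr))
        (scanned-hit (proj₁ (hit {D} eq)) i<n (proj₂ (hit {D} eq)) scanned))

    step-miss : ∀ {D i rn rz rw at ad rd ri rr ord} → Static rn rz rw at ad →
      ((ad ri ∸ rd) + (rd ∸ ad ri)) + ((1 ∸ at ri) + (at ri ∸ ad ri)) ≢ 0 →
      Scanning D i rd ri rr ord → Scanning D (suc i) rd (suc ri) rr ord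
    step-miss (static _ _ _ refl refl) neq (scanning refl refl scanned) =
      scanning refl refl (scanned-miss (miss neq) scanned)

    exec-scanBody : ∀ {D i s} → i < n → ScanningAt D i s → Exec scanBody s (ScanningAt D (suc i)) 33
    exec-scanBody {s = s} i<n (st , unt , sc) with eval s misses ≟ 0
    ... | yes eq = straight 33 (seq (if-false eq (seq store assign)) assign) (st , unt , step-hit i<n st eq sc)
    ... | no neq = straight 33 (seq (if-true neq skip) assign) (st , unt , step-miss st neq sc)

    RowStart : ℕ → State → Set
    RowStart D s = StaticAt s × Untouched s × regs s rD ≡ D × Scanned n D 0 (prefix (arrs s aOrd) (regs s rR))

    exec-scanRow : ∀ {D s} → RowStart D s → Exec scanRow s (RowStart (suc D)) (2 + (suc n * 37 + 4))
    exec-scanRow {D} (st , unt , eq , sc) =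
      straight 2 assign (st , unt , scanning eq refl sc)
      andThen λ _ inv → exec-loop (ScanningAt D) n 33
        (λ i<n (st , _ , sc) → subst₂ (λ a b → a ∸ b ≢ 0) (sym (rn≡n st)) (sym (ri≡i sc)) (m>n⇒m∸n≢0 i<n))
        (λ (st , _ , sc) → m≤n⇒m∸n≡0 (≤-reflexive (trans (rn≡n st) (sym (ri≡i sc)))))
        exec-scanBody inv
      andThen λ _ (st , unt , sc) →
        straight 4 assign (st , unt , cong suc (rd≡D sc) , scanned-next (scanned sc))
      where
      open Static
      open Scanning

    orderCost : ℕ
    orderCost = suc (suc K) * (4 + (2 + (suc n * 37 + 4)))

    exec-order : ∀ {s} → PreprocessingAt n s → K ≡ regs s rK → z ≡ regs s rZ → Untouched s →
      Exec order s (RowStart (suc K)) (8 + orderCost)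
    exec-order pre K≡ z≡ unt =
      straight 8 (seq assign (seq assign assign))
        (static (rn≡n pre) (sym z≡) (cong suc (sym K≡)) (at≡t pre) (ad≡d pre) , unt , refl , scanned-start)
      andThen λ _ → exec-loop RowStart (suc K) _
        (λ i<w (st , _ , eq , _) → subst₂ (λ a b → a ∸ b ≢ 0) (sym (rw≡w st)) (sym eq) (m>n⇒m∸n≢0 i<w))
        (λ (st , _ , eq , _) → m≤n⇒m∸n≡0 (≤-reflexive (trans (rw≡w st) (sym eq))))
        (λ _ → exec-scanRow)
      where
      open Preprocessing
      open Static using (rw≡w)

    module Tabulated (R : ℕ) (J : ℕ → ℕ) where

      Rows : ℕ → (ℕ → ℕ) → Set
      Rows r tab = ∀ q → q ≤ r → ∀ y → y ≤ K → tab (q * suc K + y) ≡ cell (prefix J q) y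

      OrderedAt : State → Set
      OrderedAt s = StaticAt s × arrs s aOrd ≡ J × regs s rR ≡ R

      FirstRowAt : ℕ → State → Set
      FirstRowAt i s = OrderedAt s × Untouched s × regs s rX ≡ suc i
        × (∀ y → y < suc i → arrs s aTab y ≡ cell [] y)

      step-firstRow : ∀ {i rx rw tab} → rx ≡ suc i → rw ≡ suc K → (∀ y → y < suc i → tab y ≡ cell [] y) →
        ∀ y → y < suc (suc i) → update tab rx rw y ≡ cell [] y
      step-firstRow refl refl below = update-below {P = λ y v → v ≡ cell [] y} refl below

      exec-firstRow : ∀ {s} → OrderedAt s → Untouched s →
        Exec firstRow s (FirstRowAt K) (5 + suc K * 11)
      exec-firstRow ord unt =
        straight 5 (seq store assign) (ord , unt , refl , λ { zero _ → refl ; (suc _) (s≤s ()) })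
        andThen λ _ → exec-loop FirstRowAt K 7
          (λ i<K ((st , _) , _ , eq , _) → subst₂ (λ a b → a ∸ b ≢ 0) (sym (rw≡w st)) (sym eq) (m>n⇒m∸n≢0 i<K))
          (λ ((st , _) , _ , eq , _) → m≤n⇒m∸n≡0 (≤-reflexive (trans (rw≡w st) (sym eq))))
          (λ { _ (ord@(st , _) , unt , eq , below) → straight 7 (seq store assign)
            (ord , unt , cong suc eq , step-firstRow eq (rw≡w st) below) })
        where open Static

      RowsAt : ℕ → State → Set
      RowsAt r s = OrderedAt s × Untouched s × regs s rRow ≡ r × regs s rBase ≡ r * suc K × Rows r (arrs s aTab)

      record Filling (r x rrow rbase rjob rc rx : ℕ) (tab : ℕ → ℕ) : Set where
        constructor filling
        field
          rrow≡r   : rrow ≡ r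
          rbase≡   : rbase ≡ r * suc K
          rjob≡    : rjob ≡ J r
          rc≡      : rc ≡ suc (crit (J r))
          rx≡x     : rx ≡ x
          complete : Rows r tab
          partial  : ∀ y → y < x → tab (suc r * suc K + y) ≡ cell (prefix J (suc r)) y

      FillingAt : ℕ → ℕ → State → Set
      FillingAt r x s = OrderedAt s × Untouched s
        × Filling r x (regs s rRow) (regs s rBase) (regs s rJob) (regs s rC) (regs s rX) (arrs s aTab)

      step-cell : ∀ {r x rw rrow rbase rjob rc rx tab v} → x < suc K → rw ≡ suc K →
        v ≡ cell (J r ∷ prefix J r) x → Filling r x rrow rbase rjob rc rx tab →
        Filling r (suc x) rrow rbase rjob rc (suc rx) (update tab ((rw + rbase) + rx) v)
      step-cell {r} {x} {tab = tab} {v} x<w refl v≡ (filling refl refl refl refl refl complete partial) =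
        filling refl refl refl refl refl
          (λ q q≤r y y≤K → trans (update-other tab v (<⇒≢ (earlier q≤r y≤K))) (complete q q≤r y y≤K))
          (below-suc (trans (update-same tab (suc r * suc K + x) v) v≡)
            (λ y y<x → trans (update-other tab v (<⇒≢ (+-monoʳ-< (suc r * suc K) y<x))) (partial y y<x)))
        where
        -- Addresses in rows up to `r` precede row `suc r`, so storing the new cell leaves the
        -- finished rows intact.
        earlier : ∀ {q y} → q ≤ r → y ≤ K → q * suc K + y < suc r * suc K + x
        earlier {q} {y} q≤r y≤K = begin-strict
          q * suc K + y      <⟨ +-monoʳ-< (q * suc K) (s≤s y≤K) ⟩
          q * suc K + suc K  ≡⟨ +-comm (q * suc K) (suc K) ⟩
          suc q * suc K      ≤⟨ *-monoˡ-≤ (suc K) (s≤s q≤r) ⟩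
          suc r * suc K      ≤⟨ m≤m+n (suc r * suc K) x ⟩
          suc r * suc K + x  ∎
          where open ≤-Reasoning

      cellSkip : ∀ {r x rn rz rw at ad rrow rbase rjob rc rx tab} → x < suc K → Static rn rz rw at ad →
        (at rjob ∸ rx) + (rx ∸ ad rjob) ≢ 0 → Filling r x rrow rbase rjob rc rx tab →
        tab (rbase + rx) + (rc ∸ tab (rbase + rx)) ≡ cell (J r ∷ prefix J r) x
      cellSkip {r} {x} x<w (static _ _ _ refl refl) g (filling refl refl refl refl refl complete _)
        rewrite complete r ≤-refl x (≤-pred x<w) with guard (J r) x
      ... | zero  = contradiction refl g
      ... | suc _ = refl

      cellTake : ∀ {r x rn rz rw at ad rrow rbase rjob rc rx tab} → x < suc K → Static rn rz rw at ad →
        (at rjob ∸ rx) + (rx ∸ ad rjob) ≡ 0 → Filling r x rrow rbase rjob rc rx tab →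
        let m = tab (rbase + rx) + (rc ∸ tab (rbase + rx)) in
        m ∸ (m ∸ tab (rbase + (rx ∸ at rjob))) ≡ cell (J r ∷ prefix J r) x
      cellTake {r} {x} x<w (static _ _ _ refl refl) g (filling refl refl refl refl refl complete _)
        rewrite complete r ≤-refl x (≤-pred x<w)
              | complete r ≤-refl (x ∸ t (J r)) (≤-trans (m∸n≤m x (t (J r))) (≤-pred x<w))
              | g = refl

      exec-cellBody : ∀ {r x s} → x < suc K → FillingAt r x s → Exec cellBody s (FillingAt r (suc x)) 50
      exec-cellBody {s = s} x<w (ord@(st , _) , unt , fill) with eval s infeasible ≟ 0
      ... | yes eq = straight 50 (seq assign (seq (if-false eq store) assign))
              (ord , unt , step-cell x<w (Static.rw≡w st) (cellTake x<w st eq fill) fill)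
      ... | no neq = straight 50 (seq assign (seq (if-true neq store) assign))
              (ord , unt , step-cell x<w (Static.rw≡w st) (cellSkip x<w st neq fill) fill)

      rows-suc : ∀ {r tab} → Rows r tab → (∀ y → y < suc K → tab (suc r * suc K + y) ≡ cell (prefix J (suc r)) y) →
        Rows (suc r) tab
      rows-suc complete new q q≤1+r y y≤K = case m≤n⇒m<n∨m≡n q≤1+r of λ where
        (inj₁ q<1+r) → complete q (≤-pred q<1+r) y y≤K
        (inj₂ refl)  → new y (s≤s y≤K)

      startRow : ∀ {r rrow rbase rn rz rw at ad ord tab} → Static rn rz rw at ad → ord ≡ J → rrow ≡ r →
        rbase ≡ r * suc K → Rows r tab →
        Filling r 0 rrow rbase (ord rrow) (suc (ad (ord rrow) ∸ at (ord rrow))) 0 tab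
      startRow (static _ _ _ refl refl) refl refl refl complete =
        filling refl refl refl refl refl complete (λ _ ())

      rowCost : ℕ
      rowCost = 13 + (suc (suc K) * 54 + 8)

      exec-rowBody : ∀ {r s} → RowsAt r s → Exec rowBody s (RowsAt (suc r)) rowCost
      exec-rowBody {r} (ord@(st , J≡ , _) , unt , row≡ , base≡ , complete) =
        straight 13 (seq assign (seq assign assign))
          (ord , unt , startRow st J≡ row≡ base≡ complete)
        andThen λ _ inv → exec-loop (FillingAt r) (suc K) 50
          (λ x<w ((st , _) , _ , fill) → subst₂ (λ a b → a ∸ b ≢ 0) (sym (rw≡w st)) (sym (rx≡x fill)) (m>n⇒m∸n≢0 x<w))
          (λ ((st , _) , _ , fill) → m≤n⇒m∸n≡0 (≤-reflexive (trans (rw≡w st) (sym (rx≡x fill)))))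
          exec-cellBody inv
        andThen λ s (ord@(st , _) , unt , fill) → straight 8 (seq assign assign)
          (ord , unt , cong suc (rrow≡r fill) , cong₂ _+_ (rw≡w st) (rbase≡ fill)
            , rows-suc {tab = arrs s aTab} (Filling.complete fill) (partial fill))
        where
        open Static
        open Filling hiding (complete)

      exec-rows : ∀ {s} → FirstRowAt K s → Exec rows s (RowsAt R) (4 + suc R * (4 + rowCost))
      exec-rows (ord , unt , _ , first) =
        straight 4 (seq assign assign) (ord , unt , refl , refl , λ { zero z≤n y y≤K → first y (s≤s y≤K) })
        andThen λ _ → exec-loop RowsAt R rowCost
          (λ r<R ((_ , _ , R≡) , _ , row≡ , _) → subst₂ (λ a b → a ∸ b ≢ 0) (sym R≡) (sym row≡) (m>n⇒m∸n≢0 r<R))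
          (λ ((_ , _ , R≡) , _ , row≡ , _) → m≤n⇒m∸n≡0 (≤-reflexive (trans R≡ (sym row≡))))
          (λ _ → exec-rowBody)

      -- `T` is fixed in advance as the least diagonal solution. This makes the search a loop with
      -- exactly `T` iterations: minimality keeps it going, feasibility stops it.
      module Optimum (T : ℕ) (T≤K : T ≤ K) (feasible : cell (prefix J R) T ≤ T)
          (minimal : ∀ l → l < T → ¬ cell (prefix J R) l ≤ l) where

        SearchingAt : ℕ → State → Set
        SearchingAt i s = RowsAt R s × regs s rT ≡ i

        searchValue : ∀ {i rbase rt tab} → i ≤ K → rbase ≡ R * suc K → Rows R tab → rt ≡ i →
          tab (rbase + rt) ∸ rt ≡ cell (prefix J R) i ∸ i
        searchValue {i} i≤K refl complete refl = cong (_∸ i) (complete R ≤-refl i i≤K)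

        exec-search : ∀ {s} → RowsAt R s → Exec search s (SearchingAt T) (2 + suc T * 11)
        exec-search inv =
          straight 2 assign (inv , refl)
          andThen λ _ → exec-loop SearchingAt T 4
            (λ { {i} {s} i<T ((_ , _ , _ , base≡ , complete) , t≡) → subst (_≢ 0)
              (sym (searchValue {tab = arrs s aTab} (≤-trans (<⇒≤ i<T) T≤K) base≡ complete t≡))
              (minimal i i<T ∘ m∸n≡0⇒m≤n) })
            (λ { {s} ((_ , _ , _ , base≡ , complete) , t≡) →
              trans (searchValue {tab = arrs s aTab} T≤K base≡ complete t≡) (m≤n⇒m∸n≡0 feasible) })
            (λ { _ (inv , t≡) → straight 4 assign (inv , cong suc t≡) })

        record Rebuilding (r x rrow rbase rx rt : ℕ) (ord tab : ℕ → ℕ) : Set where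
          constructor rebuilding
          field
            rrow≡r   : rrow ≡ r
            rbase≡   : rbase ≡ r * suc K
            rx≡x     : rx ≡ x
            rt≡T     : rt ≡ T
            ord≡J    : ord ≡ J
            complete : Rows R tab

        RebuildingAt : ℕ → ℕ → State → Set
        RebuildingAt r x s = StaticAt s
          × Rebuilding r x (regs s rRow) (regs s rBase) (regs s rX) (regs s rT) (arrs s aOrd) (arrs s aTab)

        -- Relates final to initial arrays. `unchanged` protects the entry of a job just decided
        -- while the rest of the list is processed, and also the marks of the unlisted jobs.
        record Rebuilt (r x : ℕ) (s s′ : State) : Set where
          constructor rebuilt
          field
            rz≡z      : regs s′ rZ ≡ z
            rt≡T      : regs s′ rT ≡ T
            plan      : Plan (arrs s′ aExec) (arrs s′ aStart) T (prefix J r) x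
            unchanged : ∀ j → j ∉ prefix J r →
              arrs s′ aExec j ≡ arrs s aExec j × arrs s′ aStart j ≡ arrs s aStart j

        nonempty : ∀ {r rrow} → rrow ≡ suc r → rrow ≢ 0
        nonempty refl ()

        step-skip : ∀ {r x rrow rbase rx rt rw ord tab} → rw ≡ suc K → Rebuilding (suc r) x rrow rbase rx rt ord tab →
          Rebuilding r x (rrow ∸ 1) (rbase ∸ rw) rx rt ord tab
        step-skip {r} refl (rebuilding refl refl refl refl refl complete) =
          rebuilding refl (m+n∸m≡n (suc K) (r * suc K)) refl refl refl complete

        step-take : ∀ {r x rrow rbase rx rt rw ord tab at} → rw ≡ suc K → at ≡ t →
          Rebuilding (suc r) x rrow rbase rx rt ord tab →
          Rebuilding r (x ∸ t (J r)) (rrow ∸ 1) (rbase ∸ rw) (rx ∸ at (ord (rrow ∸ 1))) rt ord tab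
        step-take {r} refl refl (rebuilding refl refl refl refl refl complete) =
          rebuilding refl (m+n∸m≡n (suc K) (r * suc K)) refl refl refl complete

        rebuildValue : ∀ {r x rrow rbase rx rt rn rz rw at ad ord tab} → r < R → x ≤ K → Static rn rz rw at ad →
          Rebuilding (suc r) x rrow rbase rx rt ord tab →
          let j = ord (rrow ∸ 1) in
          ((at j ∸ rx) + (rx ∸ ad j)) + (tab ((rbase ∸ rw) + (rx ∸ at j)) ∸ rt)
            ≡ guard (J r) x + (cell (prefix J r) (x ∸ t (J r)) ∸ T)
        rebuildValue {r} {x} r<R x≤K (static _ _ refl refl refl) (rebuilding refl refl refl refl refl complete)
          rewrite m+n∸m≡n (suc K) (r * suc K)
                | complete r (<⇒≤ r<R) (x ∸ t (J r)) (≤-trans (m∸n≤m x (t (J r))) x≤K) = refl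

        data Step (r x : ℕ) (s s′ : State) : Set where
          took : guard (J r) x ≡ 0 → cell (prefix J r) (x ∸ t (J r)) ≤ T → RebuildingAt r (x ∸ t (J r)) s′ →
            arrs s′ aExec ≡ update (arrs s aExec) (J r) 1 →
            arrs s′ aStart ≡ update (arrs s aStart) (J r) (x ∸ t (J r)) → Step r x s s′
          skipped : crit (J r) < T → cell (prefix J r) x ≤ T → RebuildingAt r x s′ →
            arrs s′ aExec ≡ arrs s aExec → arrs s′ aStart ≡ arrs s aStart → Step r x s s′

        rebuildJob : ∀ {r x rrow rbase rx rt ord tab} → Rebuilding (suc r) x rrow rbase rx rt ord tab →
          ord (rrow ∸ 1) ≡ J r
        rebuildJob (rebuilding refl _ _ _ refl _) = refl

        exec-rebuildBody : ∀ {r x s} → r < R → x ≤ K → cell (prefix J (suc r)) x ≤ T → RebuildingAt (suc r) x s →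
          Exec rebuildBody s (Step r x s) 42
        exec-rebuildBody {r} {x} {s} r<R x≤K le (st , inv)
          with guard (J r) x + (cell (prefix J r) (x ∸ t (J r)) ∸ T) ≟ 0
        ... | yes eq = straight 42
              (seq assign (seq assign (seq assign (if-false
                (trans (rebuildValue {tab = arrs s aTab} r<R x≤K st inv) eq) (seq assign (seq store store))))))
              (took (m+n≡0⇒m≡0 _ eq) (m∸n≡0⇒m≤n (m+n≡0⇒n≡0 (guard (J r) x) eq))
                (st , next)
                (cong (λ j → update (arrs s aExec) j 1) job)
                (cong₂ (update (arrs s aStart)) job (Rebuilding.rx≡x next)))
          where
          job = rebuildJob {tab = arrs s aTab} inv
          next = step-take (Static.rw≡w st) (Static.at≡t st) inv
        -- The test fails, so the entry cannot owe its small value to taking the job; skipping must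
        -- account for it.
        ... | no neq = case cell-cases (J r) (prefix J r) x le of λ where
          (inj₁ (g , fits)) → contradiction (cong₂ _+_ g (m≤n⇒m∸n≡0 fits)) neq
          (inj₂ (late , le′)) → straight 42
            (seq assign (seq assign (seq assign (if-true
              (subst (_≢ 0) (sym (rebuildValue {tab = arrs s aTab} r<R x≤K st inv)) neq) skip))))
            (skipped late le′ (st , step-skip (Static.rw≡w st) inv) refl refl)

        -- The loop decides the head first, but a `Plan` grows from the tail. It is therefore
        -- assembled on the way back from the recursion rather than carried as an invariant of
        -- `exec-loop`.
        exec-rebuildLoop : ∀ r x {s} → r ≤ R → x ≤ K → AllPairs _≢_ (prefix J r) → cell (prefix J r) x ≤ T →
          All (λ j → arrs s aExec j ≡ 0) (prefix J r) → RebuildingAt r x s →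
          Exec rebuildLoop s (Rebuilt r x s) (suc r * 44)
        exec-rebuildLoop zero zero {s} _ _ _ _ _ (st , inv) =
          straight 44 (while-false (Rebuilding.rrow≡r inv))
            (rebuilt (Static.rz≡z st) (Rebuilding.rt≡T inv) done (λ _ _ → refl , refl))
        -- A positive length left over with no jobs would mean that the sentinel `suc K` is at most
        -- `T`.
        exec-rebuildLoop zero (suc _) _ _ _ le _ _ = contradiction (≤-trans le T≤K) (<⇒≱ ≤-refl)
        exec-rebuildLoop (suc r) x {s} r<R x≤K (new ∷ uniq) le (fresh ∷ freshs) (st , inv)
          with exec-rebuildBody {s = s} r<R x≤K le (st , inv)
        ... | s′ , k , run , skipped late le′ inv′ ex≡ st≡ , k≤
          with exec-rebuildLoop r x {s′} (<⇒≤ r<R) x≤K uniq le′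
                 (subst (λ f → All (λ j → f j ≡ 0) (prefix J r)) (sym ex≡) freshs) inv′
        ...   | s″ , l , run′ , rebuilt z≡ t≡ plan unchanged , l≤ =
          s″ , _ , while-true (nonempty (Rebuilding.rrow≡r inv)) run run′
          , rebuilt z≡ t≡
              (skip late (trans (proj₁ (unchanged (J r) J∉)) (trans (cong-app ex≡ (J r)) fresh)) plan)
              (λ j j∉ → let e , f = unchanged j (j∉ ∘ there) in
                trans e (cong-app ex≡ j) , trans f (cong-app st≡ j))
          , s≤s (s≤s (+-mono-≤ k≤ l≤))
          where
          J∉ : J r ∉ prefix J r
          J∉ J∈ = All.lookup new J∈ refl
        exec-rebuildLoop (suc r) x {s} r<R x≤K (new ∷ uniq) le (fresh ∷ freshs) (st , inv)
            | s′ , k , run , took g le′ inv′ ex≡ st≡ , k≤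
          with exec-rebuildLoop r (x ∸ t (J r)) {s′} (<⇒≤ r<R) (≤-trans (m∸n≤m x (t (J r))) x≤K) uniq le′
                 (subst (λ f → All (λ j → f j ≡ 0) (prefix J r)) (sym ex≡)
                   (All.zipWith (λ { (j≢ , e) → trans (update-other (arrs s aExec) 1 (j≢ ∘ sym)) e }) (new , freshs))) inv′
        ...   | s″ , l , run′ , rebuilt z≡ t≡ plan unchanged , l≤ =
          s″ , _ , while-true (nonempty (Rebuilding.rrow≡r inv)) run run′
          , rebuilt z≡ t≡
              (subst (Plan (arrs s″ aExec) (arrs s″ aStart) T (prefix J (suc r))) (m∸n+n≡m t≤x)
                (take (subst (_≤ d (J r)) (sym (m∸n+n≡m t≤x)) x≤d)
                  (trans (proj₁ (unchanged (J r) J∉)) (trans (cong-app ex≡ (J r)) (update-same (arrs s aExec) (J r) 1)))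
                  (trans (proj₂ (unchanged (J r) J∉)) (trans (cong-app st≡ (J r)) (update-same (arrs s aStart) (J r) _)))
                  plan))
              (λ j j∉ → let e , f = unchanged j (j∉ ∘ there) in
                trans e (trans (cong-app ex≡ j) (update-other (arrs s aExec) 1 (j∉ ∘ here))) ,
                trans f (trans (cong-app st≡ j) (update-other (arrs s aStart) _ (j∉ ∘ here))))
          , s≤s (s≤s (+-mono-≤ k≤ l≤))
          where
          J∉ : J r ∉ prefix J r
          J∉ J∈ = All.lookup new J∈ refl
          t≤x : t (J r) ≤ x
          t≤x = m∸n≡0⇒m≤n (m+n≡0⇒m≡0 _ g)
          x≤d : x ≤ d (J r)
          x≤d = m∸n≡0⇒m≤n (m+n≡0⇒n≡0 (t (J r) ∸ x) g)

        exec-rebuild : ∀ {s} → AllPairs _≢_ (prefix J R) → All (λ j → arrs s aExec j ≡ 0) (prefix J R) →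
          SearchingAt T s → Exec rebuild s (Rebuilt R T s) (2 + suc R * 44)
        exec-rebuild {s} uniq fresh (((st , ord≡ , _) , _ , row≡ , base≡ , complete) , t≡) =
          straight 2 {Q = λ s′ → s′ ≡ setReg s rX (regs s rT)} assign refl
          andThen λ { _ refl → weaken (λ { (rebuilt z≡ t≡ plan same) → rebuilt z≡ t≡ plan same }) ≤-refl
            (exec-rebuildLoop R T ≤-refl T≤K uniq feasible fresh
              (st , rebuilding row≡ base≡ t≡ t≡ ord≡ complete)) }

        Finished : State → Set
        Finished s = Plan (arrs s aExec) (arrs s aStart) T (prefix J R) T
          × (∀ j → j ∉ prefix J R → arrs s aExec j ≡ executed₀ j × arrs s aStart j ≡ start₀ j)
          × (regs s rN ≢ 0 → T ≢ 0 ⊎ z ≡ 0)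
          × (regs s rN ≡ 0 → T ≡ 0 × z ≢ 0)

        exec-finish : ∀ {s s′} → Untouched s → Rebuilt R T s s′ → Exec finish s′ Finished 4
        exec-finish {s} {s′} (ex≡ , st≡) (rebuilt z≡ t≡ plan same) with regs s′ rZ ≟ 0
        ... | yes eq = straight 4 (if-false eq assign)
              (plan , (λ j j∉ → let e , f = same j j∉ in trans e (cong-app ex≡ j) , trans f (cong-app st≡ j))
              , (λ _ → inj₂ (trans (sym z≡) eq)) , λ ())
        ... | no neq = straight 4 (if-true neq assign)
              (plan , (λ j j∉ → let e , f = same j j∉ in trans e (cong-app ex≡ j) , trans f (cong-app st≡ j))
              , (λ T≢0 → inj₁ (T≢0 ∘ trans t≡)) , (λ T≡0 → trans (sym t≡) T≡0 , neq ∘ trans z≡))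

        exec-output : ∀ {s} → K ≤ Kmax → R ≤ n → AllPairs _≢_ (prefix J R) →
          All (λ j → executed₀ j ≡ 0) (prefix J R) → RowsAt R s →
          Exec (search ⨾ rebuild ⨾ finish) s Finished (U * 63)
        exec-output K≤ R≤n uniq fresh inv = weaken id
          (bound (bounded-+
            (bounded-+ (bounded-const 2) (bounded-deadlines 11 (s≤s (m≤n⇒m≤1+n (≤-trans T≤K K≤))) (m≤n*m 11 (suc n))))
            (bounded-+ (bounded-+ (bounded-const 2) (bounded-jobs 44 (s≤s R≤n) (m≤n*m 44 (suc (suc Kmax)))))
              (bounded-const 4))))
          (exec-search inv
           andThen λ _ found@((_ , unt , _) , _) → exec-rebuild uniq
             (subst (λ f → All (λ j → f j ≡ 0) (prefix J R)) (sym (proj₁ unt)) fresh) found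
           andThen λ _ → exec-finish unt)

      exec-solve : ∀ {s} → K ≤ Kmax → Scanned n (suc K) 0 (prefix J R) →
        (∀ j → j < n → Marked j (executed₀ j) (start₀ j)) →
        (z ≡ 0 → ∀ j → j < n → t j ≢ 0) → (z ≢ 0 → ∃[ j ] j < n × t j ≡ 0) →
        OrderedAt s → Untouched s → Exec (firstRow ⨾ rows ⨾ search ⨾ rebuild ⨾ finish) s SolvedAt (U * 162)
      exec-solve K≤ sc marks allPos someZero ord unt =
        weaken (λ {s} → solved {s})
          (bound (bounded-+
            (bounded-+ (bounded-const 5) (bounded-deadlines 11 (m≤n⇒m≤1+n (s≤s K≤)) (m≤n*m 11 (suc n))))
            (bounded-+ (bounded-+ (bounded-const 4) (bounded-jobs 79 (s≤s R≤n) rowCost≤)) (bounded {c = 63} ≤-refl))))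
          (exec-firstRow ord unt
           andThen λ _ first → exec-rows first
           andThen λ _ → exec-output K≤ R≤n uniq fresh)
        where
        L = prefix J R
        uniq : AllPairs _≢_ L
        uniq = AllPairs.map proj₂ (Scanned.sorted sc)
        R≤n : R ≤ n
        R≤n = prefix-length J R uniq (All.map (proj₁ ∘ proj₂) (Scanned.sound sc))
        rowCost≤ : 4 + rowCost ≤ suc (suc Kmax) * 79
        rowCost≤ = ≤-trans (+-mono-≤ (m≤n*m 17 (suc (suc Kmax)))
            (+-mono-≤ (*-monoˡ-≤ 54 (s≤s (s≤s K≤))) (m≤n*m 8 (suc (suc Kmax)))))
          (≤-reflexive (trans (cong (suc (suc Kmax) * 17 +_) (sym (*-distribˡ-+ (suc (suc Kmax)) 54 8)))
            (sym (*-distribˡ-+ (suc (suc Kmax)) 17 62))))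
        relevant : All Relevant L
        relevant = All.map proj₁ (Scanned.sound sc)
        fresh : All (λ j → executed₀ j ≡ 0) L
        fresh = All.map (λ { ((0<t , _) , j<n , _) → case marks _ j<n of λ where
          (inj₁ (t≡0 , _)) → contradiction t≡0 (>⇒≢ 0<t)
          (inj₂ (_ , e))   → e }) (Scanned.sound sc)
        greedily = greedy L relevant
        -- The greedy total is a diagonal solution, so the least one exists; it inherits the bound
        -- `K`, which keeps the search inside the row.
        optimum = least (λ T → cell L T ≤? T) (proj₁ greedily) (selection⇒cell≤ (proj₂ greedily))
        T = proj₁ optimum
        T≤K : T ≤ K
        T≤K = ≤-trans (proj₁ (proj₂ optimum))
          (selection-bound (All.map (λ (_ , j<n , _) → d≤K _ j<n) (Scanned.sound sc)) (proj₂ greedily))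
        minimal = proj₂ (proj₂ (proj₂ optimum))
        open Optimum T T≤K (proj₁ (proj₂ (proj₂ optimum))) minimal
        solved : ∀ {s} → Finished s → SolvedAt s
        solved (plan , same , success , failure) = record
          { L = L ; T = T
          ; sorted = Scanned.sorted sc
          ; sound = All.map (λ (rel , j<n , _) → rel , j<n) (Scanned.sound sc)
          ; complete = λ j rel j<n → Scanned.complete sc j rel j<n (inj₁ (s≤s (d≤K j j<n)))
          ; plan = plan
          ; minimal = λ x S → ≮⇒≥ λ x<T → minimal x x<T (selection⇒cell≤ S)
          ; marks = λ j j<n j∉ → subst₂ (Marked j) (sym (proj₁ (same j j∉))) (sym (proj₂ (same j j∉))) (marks j j<n)
          ; success = λ o≢0 → case success o≢0 of λ where
              (inj₁ T≢0) → inj₁ T≢0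
              (inj₂ z≡0) → inj₂ (allPos z≡0)
          ; failure = λ o≡0 → proj₁ (failure o≡0) , someZero (proj₂ (failure o≡0))
          }

  -- In units of `U`, preprocessing takes 6 + 28, sorting 8 + 47 and the remaining phases 162. Each
  -- loop constant is the body budget plus one test, for instance 28 = 24 + 4.
  exec-program : ∀ {s} → regs s rN ≡ n → arrs s aT ≡ t → arrs s aD ≡ d → Exec program s SolvedAt (U * 251)
  exec-program n≡ t≡ d≡ =
    weaken id
      (bound (bounded-+ (bounded-+ (bounded-const 6) (bounded-jobs 28 ≤-refl (m≤n*m 28 (suc (suc Kmax)))))
        (bounded {c = 217} ≤-refl)))
      (exec-preprocess n≡ t≡ d≡ andThen λ s₁ pre →
        let open Preprocessing pre
            open Ordered (regs s₁ rK) (regs s₁ rZ) (arrs s₁ aExec) (arrs s₁ aStart) d≤k in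
        weaken id (bound (bounded-+
            (bounded-+ (bounded-const 8) (bounded-deadlines 47 (s≤s (s≤s k≤Kmax)) scanCost≤))
            (bounded {c = 162} ≤-refl)))
          (exec-order pre refl refl (refl , refl) andThen λ s₂ (st , unt , _ , sc) →
            let open Tabulated (regs s₂ rR) (arrs s₂ aOrd) in
            exec-solve k≤Kmax sc marks allPos someZero (st , refl , refl) unt))
    where
    scanCost≤ : 4 + (2 + (suc n * 37 + 4)) ≤ suc n * 47
    scanCost≤ = ≤-trans (+-mono-≤ (m≤n*m 6 (suc n)) (+-monoʳ-≤ (suc n * 37) (m≤n*m 4 (suc n))))
      (≤-reflexive (trans (cong (suc n * 6 +_) (sym (*-distribˡ-+ (suc n) 37 4))) (sym (*-distribˡ-+ (suc n) 6 41))))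

-- Schedules

pad-toℕ : ∀ {n} (f : Fin n → ℕ) i → pad f (toℕ i) ≡ f i
pad-toℕ f zero    = refl
pad-toℕ f (suc i) = pad-toℕ (f ∘ suc) i

pad≤max : ∀ {n} (f : Fin n → ℕ) j → pad f j ≤ Vector.foldr _⊔_ 0 f
pad≤max {zero}  f j       = z≤n
pad≤max {suc n} f zero    = m≤m⊔n (f zero) _
pad≤max {suc n} f (suc j) = ≤-trans (pad≤max (f ∘ suc) j) (m≤n⊔m (f zero) _)

padMaybe : ∀ {A : Set} {n} → (Fin n → Maybe A) → ℕ → Maybe A
padMaybe {n = zero}  f j       = nothing
padMaybe {n = suc n} f zero    = f zero
padMaybe {n = suc n} f (suc j) = padMaybe (f ∘ suc) j

padMaybe-toℕ : ∀ {A : Set} {n} (f : Fin n → Maybe A) i → padMaybe f (toℕ i) ≡ f i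
padMaybe-toℕ f zero    = refl
padMaybe-toℕ f (suc i) = padMaybe-toℕ (f ∘ suc) i

padMaybe-just : ∀ {A : Set} {n} (f : Fin n → Maybe A) j {x} → padMaybe f j ≡ just x → ∃[ i ] toℕ i ≡ j × f i ≡ just x
padMaybe-just {n = suc n} f zero    eq = zero , refl , eq
padMaybe-just {n = suc n} f (suc j) eq with padMaybe-just (f ∘ suc) j eq
... | i , i≡j , fi≡ = suc i , cong suc i≡j , fi≡

-- Sums and maxima over all jobs

sumBelow : ℕ → (ℕ → ℕ) → ℕ
sumBelow zero    f = 0
sumBelow (suc n) f = f 0 + sumBelow n (f ∘ suc)

sumBelow-zero : ∀ n f → (∀ j → j < n → f j ≡ 0) → sumBelow n f ≡ 0
sumBelow-zero zero    f f≡0 = refl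
sumBelow-zero (suc n) f f≡0 = cong₂ _+_ (f≡0 0 (s≤s z≤n)) (sumBelow-zero n (f ∘ suc) (λ j j<n → f≡0 (suc j) (s≤s j<n)))

sumBelow-remove : ∀ n f j → j < n → sumBelow n f ≡ f j + sumBelow n (update f j 0)
sumBelow-remove (suc n) f zero    _         = refl
sumBelow-remove (suc n) f (suc j) (s≤s j<n) = begin
  f 0 + sumBelow n (f ∘ suc)          ≡⟨ cong (f 0 +_) (sumBelow-remove n (f ∘ suc) j j<n) ⟩
  f 0 + (f (suc j) + rest)            ≡⟨ sym (+-assoc (f 0) (f (suc j)) rest) ⟩
  (f 0 + f (suc j)) + rest            ≡⟨ cong (_+ rest) (+-comm (f 0) (f (suc j))) ⟩
  (f (suc j) + f 0) + rest            ≡⟨ +-assoc (f (suc j)) (f 0) rest ⟩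
  f (suc j) + (f 0 + rest)            ∎
  where
  open ≡-Reasoning
  rest = sumBelow n (update (f ∘ suc) j 0)

-- Splitting off the head and setting `f` to 0 there preserves the hypothesis for the tail;
-- distinctness leaves the values on the tail unchanged.
sumBelow-list : ∀ n f L → AllPairs _≢_ L → All (_< n) L → (∀ j → j < n → j ∉ L → f j ≡ 0) →
  sumBelow n f ≡ sum (map f L)
sumBelow-list n f []      _            _           f≡0 = sumBelow-zero n f (λ j j<n → f≡0 j j<n λ ())
sumBelow-list n f (j ∷ L) (new ∷ uniq) (j<n ∷ L<n) f≡0 = trans (sumBelow-remove n f j j<n) (cong (f j +_)
  (trans (sumBelow-list n (update f j 0) L uniq L<n off)
    (cong sum (map-cong-local (All.map (λ j≢k → update-other f 0 (j≢k ∘ sym)) new)))))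
  where
  off : ∀ k → k < n → k ∉ L → update f j 0 k ≡ 0
  off k k<n k∉L = case k ≟ j of λ where
    (yes refl) → update-same f k 0
    (no k≢j)   → trans (update-other f 0 k≢j) (f≡0 k k<n λ { (here e) → k≢j e ; (there k∈L) → k∉L k∈L })

foldr-+-fromℕ : ∀ {n} (F : Fin n → ℚ) f → (∀ i → F i ≡ fromℕ (f (toℕ i))) →
  Vector.foldr ℚ._+_ 0ℚ F ≡ fromℕ (sumBelow n f)
foldr-+-fromℕ {zero}  F f F≡f = refl
foldr-+-fromℕ {suc n} F f F≡f = trans
  (cong₂ ℚ._+_ (F≡f zero) (foldr-+-fromℕ (F ∘ suc) (f ∘ suc) (F≡f ∘ suc)))
  (sym (fromℕ-+ (f 0) (sumBelow n (f ∘ suc))))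

≤-foldr-⊔ : ∀ {n} (F : Fin n → ℚ) i → F i ℚ.≤ Vector.foldr ℚ._⊔_ 0ℚ F
≤-foldr-⊔ F zero    = ℚ.p≤p⊔q (F zero) _
≤-foldr-⊔ F (suc i) = ℚ.≤-trans (≤-foldr-⊔ (F ∘ suc) i) (ℚ.p≤q⊔p (F zero) _)

0≤foldr-⊔ : ∀ {n} (F : Fin n → ℚ) → 0ℚ ℚ.≤ Vector.foldr ℚ._⊔_ 0ℚ F
0≤foldr-⊔ {zero}  F = ℚ.≤-refl
0≤foldr-⊔ {suc n} F = ℚ.≤-trans (0≤foldr-⊔ (F ∘ suc)) (ℚ.p≤q⊔p (F zero) _)

foldr-⊔-lub : ∀ {n} (F : Fin n → ℚ) {u} → 0ℚ ℚ.≤ u → (∀ i → F i ℚ.≤ u) → Vector.foldr ℚ._⊔_ 0ℚ F ℚ.≤ u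
foldr-⊔-lub {zero}  F 0≤u F≤u = 0≤u
foldr-⊔-lub {suc n} F 0≤u F≤u = ℚ.⊔-lub (F≤u zero) (foldr-⊔-lub (F ∘ suc) 0≤u (F≤u ∘ suc))

2+m≤3*[1⊔m] : ∀ m → 2 + m ≤ 3 * (1 ⊔ m)
2+m≤3*[1⊔m] zero    = s≤s (s≤s z≤n)
2+m≤3*[1⊔m] (suc m) = ≤-trans (≤-reflexive (+-comm 2 (suc m)))
  (+-monoʳ-≤ (suc m) (*-monoʳ-≤ 2 {1} {suc m} (s≤s z≤n)))

1+m≤2*[1⊔m] : ∀ m → 1 + m ≤ 2 * (1 ⊔ m)
1+m≤2*[1⊔m] zero    = s≤s z≤n
1+m≤2*[1⊔m] (suc m) = ≤-trans (≤-reflexive (+-comm 1 (suc m))) (+-monoʳ-≤ (suc m) (s≤s z≤n))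

-- The factor 6 is 3 times 2, from `2 + K ≤ 3 * (1 ⊔ K)` and `1 + n ≤ 2 * (1 ⊔ n)`.
cost≤ : ∀ c K n → (2 + K) * (1 + n) * c ≤ c * 6 * ((1 ⊔ K) * (1 ⊔ n))
cost≤ c K n = begin
  (2 + K) * (1 + n) * c                    ≡⟨ *-comm ((2 + K) * (1 + n)) c ⟩
  c * ((2 + K) * (1 + n))                  ≤⟨ *-monoʳ-≤ c (*-mono-≤ (2+m≤3*[1⊔m] K) (1+m≤2*[1⊔m] n)) ⟩
  c * ((3 * (1 ⊔ K)) * (2 * (1 ⊔ n)))      ≡⟨ cong (c *_) ([m*n]*[o*p]≡[m*o]*[n*p] 3 (1 ⊔ K) 2 (1 ⊔ n)) ⟩
  c * (6 * ((1 ⊔ K) * (1 ⊔ n)))            ≡⟨ sym (*-assoc c 6 ((1 ⊔ K) * (1 ⊔ n))) ⟩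
  c * 6 * ((1 ⊔ K) * (1 ⊔ n))              ∎
  where open ≤-Reasoning

module Bridge (I : Instance) (released : ReleasedAtZero I) where
  open Instance I

  len due : ℕ → ℕ
  len = pad processing
  due = pad deadline

  open Jobs len due

  len≡ : ∀ i → fromℕ (processing i) ≡ fromℕ (len (toℕ i))
  len≡ i = cong fromℕ (sym (pad-toℕ processing i))

  due≡ : ∀ i → fromℕ (deadline i) ≡ fromℕ (due (toℕ i))
  due≡ i = cong fromℕ (sym (pad-toℕ deadline i))

  arrival≡0 : ∀ i → fromℕ (arrival i) ≡ 0ℚ
  arrival≡0 i = cong fromℕ (released i)

  -- Every feasible schedule yields a selection

  module LowerBound (σ : Schedule I) (F : Feasible I σ)
      (L : List ℕ) (sorted : AllPairs (λ j k → due k ≤ due j × j ≢ k) L)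
      (sound : All (λ j → Relevant j × j < n) L) (complete : ∀ j → Relevant j → j < n → j ∈ L) where
    open Feasible F

    started : ℕ → Maybe ℚ
    started = padMaybe σ

    work : ℕ → ℕ
    work j = maybe′ (λ _ → len j) 0 (started j)

    W : ℕ
    W = sum (map work L)

    uniq : AllPairs _≢_ L
    uniq = AllPairs.map proj₂ sorted

    0≤start : ∀ j {s} → started j ≡ just s → 0ℚ ℚ.≤ s
    0≤start j {s} eq with padMaybe-just σ j eq
    ... | i , refl , σi≡ = subst (ℚ._≤ s) (arrival≡0 i) (proj₁ (window i s σi≡))

    end≤due : ∀ j {s} → started j ≡ just s → s ℚ.+ fromℕ (len j) ℚ.≤ fromℕ (due j)
    end≤due j {s} eq with padMaybe-just σ j eq
    ... | i , refl , σi≡ = subst₂ (λ p q → s ℚ.+ p ℚ.≤ q) (len≡ i) (due≡ i)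
      (p≤q-r⇒p+r≤q s _ _ (proj₂ (window i s σi≡)))

    len≤due : ∀ j {s} → started j ≡ just s → len j ≤ due j
    len≤due j {s} eq = fromℕ-cancel-≤ (ℚ.≤-trans
      (subst (ℚ._≤ s ℚ.+ fromℕ (len j)) (ℚ.+-identityˡ (fromℕ (len j))) (ℚ.+-monoˡ-≤ (fromℕ (len j)) (0≤start j eq)))
      (end≤due j eq))

    apart : ∀ {j k r s} → j ≢ k → started j ≡ just r → started k ≡ just s → Disjoint (r , len j) (s , len k)
    apart {j} {k} {r} {s} j≢k j↦r k↦s τ ((r≤τ , τ<) , (s≤τ , τ<′)) with padMaybe-just σ j j↦r | padMaybe-just σ k k↦s
    ... | i , refl , σi≡ | i′ , refl , σi′≡ = disjoint i i′ (j≢k ∘ cong toℕ) τ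
      ( (r , σi≡ , r≤τ , subst (λ p → τ ℚ.< r ℚ.+ p) (sym (len≡ i)) τ<)
      , (s , σi′≡ , s≤τ , subst (λ p → τ ℚ.< s ℚ.+ p) (sym (len≡ i′)) τ<′))

    intervals : List ℕ → List Interval
    intervals []      = []
    intervals (j ∷ M) = maybe′ (λ s → (s , len j) ∷ intervals M) (intervals M) (started j)

    totalLength-intervals : ∀ M → totalLength (intervals M) ≡ sum (map work M)
    totalLength-intervals []      = refl
    totalLength-intervals (j ∷ M) with started j
    ... | nothing = totalLength-intervals M
    ... | just _  = cong (len j +_) (totalLength-intervals M)

    intervals-all : ∀ {P : Interval → Set} M → All (λ j → ∀ s → started j ≡ just s → P (s , len j)) M →
      All P (intervals M)
    intervals-all []      []       = []
    intervals-all (j ∷ M) (p ∷ ps) with started j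
    ... | nothing = intervals-all M ps
    ... | just s  = p s refl ∷ intervals-all M ps

    intervals-lookup : ∀ {P : Interval → Set} {j s} M → All P (intervals M) → j ∈ M → started j ≡ just s → P (s , len j)
    intervals-lookup (j ∷ M) ps (here refl) eq with started j
    intervals-lookup (j ∷ M) (p ∷ ps) (here refl) refl | just _ = p
    intervals-lookup (k ∷ M) ps (there j∈M) eq with started k
    intervals-lookup (k ∷ M) ps       (there j∈M) eq | nothing = intervals-lookup M ps j∈M eq
    intervals-lookup (k ∷ M) (_ ∷ ps) (there j∈M) eq | just _  = intervals-lookup M ps j∈M eq

    intervals-disjoint : ∀ M → AllPairs _≢_ M → AllPairs Disjoint (intervals M)
    intervals-disjoint []      _            = []
    intervals-disjoint (j ∷ M) (new ∷ uniq) with started j in j↦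
    ... | nothing = intervals-disjoint M uniq
    ... | just r  = intervals-all M (All.map (λ j≢k s k↦ → apart j≢k j↦ k↦) new) ∷ intervals-disjoint M uniq

    -- Used with a deadline for `D` to show that the selection is on time, and with the makespan for
    -- `D` to bound that objective from below.
    work≤ : ∀ {D} M → AllPairs _≢_ M → All Relevant M → 0ℚ ℚ.≤ D →
      All (λ j → ∀ s → started j ≡ just s → s ℚ.+ fromℕ (len j) ℚ.≤ D) M → fromℕ (sum (map work M)) ℚ.≤ D
    work≤ {D} M uniq rel 0≤D ends = subst (λ w → fromℕ w ℚ.≤ D) (totalLength-intervals M)
      (packing (intervals M) (intervals-disjoint M uniq)
        (intervals-all M (All.zipWith (λ ((0<t , _) , e) s eq → 0<t , e s eq) (rel , ends))) 0≤D
        (intervals-all M (All.tabulate λ {j} _ _ eq → 0≤start j eq)))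

    skipped-critical : ∀ {j} → Relevant j → j < n → started j ≡ nothing → crit j < W
    skipped-critical {j} (_ , t≤d) j<n j↦ = ≰⇒> λ W≤c →
      let i = fromℕ< j<n
          i≡j = toℕ-fromℕ< j<n
          τ , 0≤τ , τ≤ , free = gap (intervals L) 0ℚ
          τ≤W = subst (τ ℚ.≤_) (trans (ℚ.+-identityˡ _) (cong fromℕ (totalLength-intervals L))) τ≤
          W+t≤d = subst (W + len j ≤_) (m∸n+n≡m t≤d) (+-monoˡ-≤ (len j) W≤c)
          unstarted = trans (sym (padMaybe-toℕ σ i)) (trans (cong started i≡j) j↦)
      in busy τ (idle τ free) i
        ( (λ (s , σi≡ , _) → case trans (sym unstarted) σi≡ of λ ())
        , subst (ℚ._≤ τ) (sym (arrival≡0 i)) 0≤τ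
        , p+r≤q⇒p≤q-r τ _ _ (subst₂ (λ p q → τ ℚ.+ p ℚ.≤ q)
            (sym (trans (len≡ i) (cong (fromℕ ∘ len) i≡j))) (sym (trans (due≡ i) (cong (fromℕ ∘ due) i≡j)))
            (ℚ.≤-trans (ℚ.+-monoˡ-≤ (fromℕ (len j)) τ≤W)
              (subst (ℚ._≤ fromℕ (due j)) (fromℕ-+ W (len j)) (fromℕ-mono-≤ W+t≤d)))))
      where
      -- A job in process has positive length and, being started, fits its deadline. It is thus
      -- relevant and listed, so an instant free of listed intervals is idle.
      idle : ∀ τ → All (¬_ ∘ Covers τ) (intervals L) → ¬ (∃[ i ] InProcess I σ i τ)
      idle τ free (i , s , σi≡ , s≤τ , τ<) = intervals-lookup L free
          (complete (toℕ i) (n≢0⇒n>0 pos , len≤due (toℕ i) i↦) (toℕ<n i)) i↦ (s≤τ , τ<′)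
        where
        i↦ = trans (padMaybe-toℕ σ i) σi≡
        τ<′ = subst (λ p → τ ℚ.< s ℚ.+ p) (len≡ i) τ<
        pos : len (toℕ i) ≢ 0
        pos t≡0 = ℚ.<-irrefl refl (ℚ.<-≤-trans τ<′ (subst (ℚ._≤ τ)
          (sym (trans (cong (λ k → s ℚ.+ fromℕ k) t≡0) (ℚ.+-identityʳ s))) s≤τ))

    selection : Selection W L W
    selection = go L sorted sound
      where
      go : ∀ M → AllPairs (λ j k → due k ≤ due j × j ≢ k) M → All (λ j → Relevant j × j < n) M →
        Selection W M (sum (map work M))
      go []      _              _                         = done
      go (j ∷ M) srt@(earlier ∷ sorted) snd@((rel , j<n) ∷ sound) with started j in j↦
      ... | nothing = skip (skipped-critical rel j<n j↦) (go M sorted sound)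
      ... | just s  = subst (Selection W (j ∷ M)) (+-comm (sum (map work M)) (len j))
        (take (fromℕ-cancel-≤ (subst (λ w → fromℕ w ℚ.≤ fromℕ (due j)) total
          -- The tail holds only jobs due no later than `j`, so everything executed in `j ∷ M` must
          -- fit before `due j`.
          (work≤ (j ∷ M) (AllPairs.map proj₂ srt) (All.map proj₁ snd) (0≤fromℕ (due j))
            ((λ _ → end≤due j) ∷ All.map (λ {k} (dk≤dj , _) _ eq → ℚ.≤-trans (end≤due k eq) (fromℕ-mono-≤ dk≤dj)) earlier))))
          (go M sorted sound))
        where
        total : work j + sum (map work M) ≡ sum (map work M) + len j
        total = trans (cong (λ m → maybe′ (λ _ → len j) 0 m + sum (map work M)) j↦) (+-comm (len j) _)

    unlisted-work : ∀ j → j < n → j ∉ L → work j ≡ 0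
    unlisted-work j j<n j∉L with started j in j↦
    ... | nothing = refl
    ... | just _ with len j ≟ 0
    ...   | yes t≡0 = t≡0
    ...   | no t≢0  = contradiction (complete j (n≢0⇒n>0 t≢0 , len≤due j j↦) j<n) j∉L

    sumBelow-work : sumBelow n work ≡ W
    sumBelow-work = sumBelow-list n work L uniq (All.map proj₂ sound) unlisted-work

    work-toℕ : ∀ i → maybe′ (λ _ → fromℕ (processing i)) 0ℚ (σ i) ≡ fromℕ (work (toℕ i))
    work-toℕ i rewrite padMaybe-toℕ σ i with σ i
    ... | nothing = refl
    ... | just _  = len≡ i

    -- A start within the window guarantees completion by the deadline, so the first two objectives
    -- coincide on feasible schedules.
    completed : ∀ i → maybe′ (λ s → if does (s ℚ.+ fromℕ (processing i) ℚ.≤? fromℕ (deadline i))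
        then fromℕ (processing i) else 0ℚ) 0ℚ (σ i) ≡ maybe′ (λ _ → fromℕ (processing i)) 0ℚ (σ i)
    completed i with σ i in σi≡
    ... | nothing = refl
    ... | just s  = cong (if_then fromℕ (processing i) else 0ℚ)
      (dec-true (s ℚ.+ fromℕ (processing i) ℚ.≤? fromℕ (deadline i)) (p≤q-r⇒p+r≤q s _ _ (proj₂ (window i s σi≡))))

    totalWork≡W : value I σ totalWork ≡ fromℕ W
    totalWork≡W = trans (foldr-+-fromℕ _ work work-toℕ) (cong fromℕ sumBelow-work)

    weightedCompleted≡W : value I σ weightedCompleted ≡ fromℕ W
    weightedCompleted≡W = trans (foldr-+-fromℕ _ work (λ i → trans (completed i) (work-toℕ i))) (cong fromℕ sumBelow-work)

    completion : Fin n → ℚ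
    completion i = maybe′ (λ s → s ℚ.+ fromℕ (processing i)) 0ℚ (σ i)

    W≤makespan : fromℕ W ℚ.≤ value I σ makespan
    W≤makespan = work≤ L uniq (All.map proj₁ sound) (0≤foldr-⊔ completion) (All.tabulate λ {j} _ s eq → ends j s eq)
      where
      ends : ∀ j s → started j ≡ just s → s ℚ.+ fromℕ (len j) ℚ.≤ value I σ makespan
      ends j s eq with padMaybe-just σ j eq
      ... | i , refl , σi≡ = subst (ℚ._≤ value I σ makespan)
        (trans (cong (maybe′ (λ s → s ℚ.+ fromℕ (processing i)) 0ℚ) σi≡) (cong (s ℚ.+_) (len≡ i)))
        (≤-foldr-⊔ completion i)

    W≤value : ∀ obj → fromℕ W ℚ.≤ value I σ obj
    W≤value totalWork         = ℚ.≤-reflexive (sym totalWork≡W)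
    W≤value weightedCompleted = ℚ.≤-reflexive (sym weightedCompleted≡W)
    W≤value makespan          = W≤makespan

  open Verify n len due (maxDeadline I) (λ j _ → pad≤max deadline j)

  decode : (executed start : ℕ → ℕ) → Schedule I
  decode executed start i = if executed (toℕ i) ≡ᵇ 0 then nothing else just (fromℕ (start (toℕ i)))

  -- The computed schedule is feasible and attains the bound

  module Attained {reported : ℕ} {executed start : ℕ → ℕ} (S : Solved reported executed start)
      (nonempty : Solved.T S ≢ 0 ⊎ (∀ j → j < n → len j ≢ 0)) where
    open Solved S

    σ : Schedule I
    σ = decode executed start

    decode-executed : ∀ {i} → executed (toℕ i) ≢ 0 → σ i ≡ just (fromℕ (start (toℕ i)))
    decode-executed {i} e≢0 with executed (toℕ i)
    ... | zero  = contradiction refl e≢0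
    ... | suc _ = refl

    decode-just : ∀ {i s} → σ i ≡ just s → executed (toℕ i) ≢ 0 × s ≡ fromℕ (start (toℕ i))
    decode-just {i} σi≡ with executed (toℕ i)
    ... | suc _ = (λ ()) , sym (just-injective σi≡)

    data Status (j : ℕ) : Set where
      planned    : j ∈ L → Status j
      trivial    : len j ≡ 0 → executed j ≡ 1 → start j ≡ 0 → Status j
      impossible : due j < len j → executed j ≡ 0 → Status j

    status : ∀ j → j < n → Status j
    status j j<n with j ∈? L
    ... | yes j∈L = planned j∈L
    ... | no j∉L with marks j j<n j∉L
    ...   | inj₁ (t≡0 , e , s) = trivial t≡0 e s
    ...   | inj₂ (t≢0 , e)     = impossible (≰⇒> λ t≤d → j∉L (complete j (n≢0⇒n>0 t≢0 , t≤d) j<n)) e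

    end≤due : ∀ i → executed (toℕ i) ≢ 0 → start (toℕ i) + len (toℕ i) ≤ due (toℕ i)
    end≤due i e≢0 with status (toℕ i) (toℕ<n i)
    ... | planned i∈L      = plan-deadline plan i∈L e≢0
    ... | trivial t≡0 _ s≡0 = subst (_≤ due (toℕ i)) (sym (cong₂ _+_ s≡0 t≡0)) z≤n
    ... | impossible _ e   = contradiction e e≢0

    end≤T : ∀ i → executed (toℕ i) ≢ 0 → start (toℕ i) + len (toℕ i) ≤ T
    end≤T i e≢0 with status (toℕ i) (toℕ<n i)
    ... | planned i∈L      = plan-end plan i∈L e≢0
    ... | trivial t≡0 _ s≡0 = subst (_≤ T) (sym (cong₂ _+_ s≡0 t≡0)) z≤n
    ... | impossible _ e   = contradiction e e≢0

    end≡ : ∀ i → fromℕ (start (toℕ i)) ℚ.+ fromℕ (processing i) ≡ fromℕ (start (toℕ i) + len (toℕ i))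
    end≡ i = trans (cong (fromℕ (start (toℕ i)) ℚ.+_) (len≡ i)) (sym (fromℕ-+ (start (toℕ i)) (len (toℕ i))))

    running : ∀ {i τ} → InProcess I σ i τ →
      executed (toℕ i) ≢ 0 × fromℕ (start (toℕ i)) ℚ.≤ τ × τ ℚ.< fromℕ (start (toℕ i) + len (toℕ i))
    running {i} {τ} (s , σi≡ , s≤τ , τ<) with decode-just {i} σi≡
    ... | e≢0 , refl = e≢0 , s≤τ , subst (τ ℚ.<_) (end≡ i) τ<

    running-planned : ∀ {i τ} → InProcess I σ i τ → toℕ i ∈ L
    running-planned {i} {τ} p with status (toℕ i) (toℕ<n i) | running {i} p
    ... | planned i∈L       | _               = i∈L
    ... | impossible _ e    | e≢0 , _         = contradiction e e≢0
    ... | trivial t≡0 _ _   | _ , s≤τ , τ<end = contradiction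
      (ℚ.≤-<-trans s≤τ (subst (λ k → τ ℚ.< fromℕ k) (trans (cong (start (toℕ i) +_) t≡0) (+-identityʳ _)) τ<end))
      (ℚ.<-irrefl refl)

    σ-disjoint : ∀ i j → i ≢ j → ∀ τ → ¬ (InProcess I σ i τ × InProcess I σ j τ)
    σ-disjoint i j i≢j τ (p , q) =
      let ei , si≤τ , τ<i = running {i} p
          ej , sj≤τ , τ<j = running {j} q
      in case plan-apart plan (running-planned p) (running-planned q) (i≢j ∘ toℕ-injective) ei ej of λ where
        (inj₁ ei≤sj) → ℚ.<-irrefl refl (ℚ.<-≤-trans τ<i (ℚ.≤-trans (fromℕ-mono-≤ ei≤sj) sj≤τ))
        (inj₂ ej≤si) → ℚ.<-irrefl refl (ℚ.<-≤-trans τ<j (ℚ.≤-trans (fromℕ-mono-≤ ej≤si) si≤τ))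

    -- The plan has no gaps: either `τ` has reached the start of the last taken job, which runs up
    -- to the end, or it lies in the part filled by the tail.
    covered : ∀ {M x τ} → Plan executed start T M x → 0ℚ ℚ.≤ τ → τ ℚ.< fromℕ x →
      ∃[ j ] j ∈ M × executed j ≢ 0 × fromℕ (start j) ℚ.≤ τ × τ ℚ.< fromℕ (start j + len j)
    covered done 0≤τ τ<x = contradiction (ℚ.≤-<-trans 0≤τ τ<x) (ℚ.<-irrefl refl)
    covered (skip _ _ P) 0≤τ τ<x =
      let j , j∈M , rest = covered P 0≤τ τ<x in j , there j∈M , rest
    covered {τ = τ} (take {j} {x = x} _ e s P) 0≤τ τ<end = case fromℕ x ℚ.≤? τ of λ where
      (yes x≤τ) → j , here refl , (λ e≡0 → case trans (sym e≡0) e of λ ())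
        , subst (λ k → fromℕ k ℚ.≤ τ) (sym s) x≤τ , subst (λ k → τ ℚ.< fromℕ (k + len j)) (sym s) τ<end
      (no x≰τ) → let k , k∈M , rest = covered P 0≤τ (ℚ.≰⇒> x≰τ) in k , there k∈M , rest

    idle⇒T≤ : ∀ {τ} → ¬ (∃[ i ] InProcess I σ i τ) → 0ℚ ℚ.≤ τ → fromℕ T ℚ.≤ τ
    idle⇒T≤ {τ} idle 0≤τ = ℚ.≮⇒≥ λ τ<T →
      let j , j∈L , e≢0 , s≤τ , τ<end = covered plan 0≤τ τ<T
          j<n = proj₂ (All.lookup sound j∈L)
          i = fromℕ< j<n
          i≡j = sym (toℕ-fromℕ< j<n)
      in idle (i , fromℕ (start (toℕ i))
        , decode-executed {i} (subst (λ k → executed k ≢ 0) i≡j e≢0)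
        , subst (λ k → fromℕ (start k) ℚ.≤ τ) i≡j s≤τ
        , subst (τ ℚ.<_) (sym (end≡ i)) (subst (λ k → τ ℚ.< fromℕ (start k + len k)) i≡j τ<end))

    started-before : ∀ {i τ} → executed (toℕ i) ≢ 0 → start (toℕ i) < T → fromℕ T ℚ.≤ τ → StartedBefore I σ i τ
    started-before {i} e≢0 s<T T≤τ = _ , decode-executed {i} e≢0 , ℚ.<-≤-trans (fromℕ-mono-< s<T) T≤τ

    σ-busy : ∀ τ → ¬ (∃[ i ] InProcess I σ i τ) → ∀ j → ¬ Executable I σ j τ
    σ-busy τ idle j (unstarted , a≤τ , τ≤c) = case status (toℕ j) (toℕ<n j) of λ where
        (trivial t≡0 e s≡0) → case nonempty of λ where
          -- A start at time 0 counts as earlier than `τ` only because `T` is positive and idleness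
          -- gives `T ≤ τ`.
          (inj₁ T≢0) → unstarted (started-before {j} (λ e≡0 → case trans (sym e≡0) e of λ ())
            (subst (_< T) (sym s≡0) (n≢0⇒n>0 T≢0)) T≤τ)
          (inj₂ pos) → pos (toℕ j) (toℕ<n j) t≡0
        (impossible d<t _) → <⇒≱ d<t (≤-trans (m≤n+m _ 0) (fits 0 0≤τ))
        (planned j∈L) → case executed (toℕ j) ≟ 0 of λ where
          (no e≢0) → unstarted (started-before {j} e≢0
            (<-≤-trans (m<m+n (start (toℕ j)) (proj₁ (proj₁ (All.lookup sound j∈L)))) (end≤T j e≢0)) T≤τ)
          (yes e≡0) → <⇒≱ (plan-skipped plan j∈L e≡0)
            (m+n≤o⇒m≤o∸n T (fits T T≤τ))
      where
      0≤τ = subst (ℚ._≤ τ) (arrival≡0 j) a≤τ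
      T≤τ = idle⇒T≤ idle 0≤τ
      -- Turns `τ ≤ c` into an inequality of integers. It is used at 0 against jobs longer than
      -- their deadline and at `T` against skipped ones.
      fits : ∀ k → fromℕ k ℚ.≤ τ → k + len (toℕ j) ≤ due (toℕ j)
      fits k k≤τ = fromℕ-cancel-≤ (subst₂ ℚ._≤_
        (trans (cong (fromℕ k ℚ.+_) (len≡ j)) (sym (fromℕ-+ k (len (toℕ j))))) (due≡ j)
        (ℚ.≤-trans (ℚ.+-monoˡ-≤ (fromℕ (processing j)) k≤τ) (p≤q-r⇒p+r≤q τ _ _ τ≤c)))

    feasible : Feasible I σ
    feasible = record
      { window = λ i s σi≡ → let e≢0 , s≡ = decode-just {i} σi≡ in
            subst₂ ℚ._≤_ (sym (arrival≡0 i)) (sym s≡) (0≤fromℕ (start (toℕ i)))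
          , p+r≤q⇒p≤q-r s _ _ (subst₂ ℚ._≤_
              (trans (sym (end≡ i)) (cong (ℚ._+ fromℕ (processing i)) (sym s≡))) (sym (due≡ i))
              (fromℕ-mono-≤ (end≤due i e≢0)))
      ; disjoint = σ-disjoint
      ; busy = σ-busy
      }

    -- Applied to the constructed schedule itself, the general analysis evaluates the first two
    -- objectives as `W`, so only `W ≡ T` remains for them.
    open LowerBound σ feasible L sorted sound complete using (W; work; totalWork≡W; weightedCompleted≡W)

    work≡ : ∀ {j} → j ∈ L → work j ≡ (if executed j ≡ᵇ 0 then 0 else len j)
    work≡ {j} j∈L = subst (λ k → work k ≡ (if executed k ≡ᵇ 0 then 0 else len k)) (toℕ-fromℕ< j<n) (go (fromℕ< j<n))
      where
      j<n = proj₂ (All.lookup sound j∈L)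
      go : ∀ i → work (toℕ i) ≡ (if executed (toℕ i) ≡ᵇ 0 then 0 else len (toℕ i))
      go i rewrite padMaybe-toℕ σ i with executed (toℕ i)
      ... | zero  = refl
      ... | suc _ = refl

    W≡T : W ≡ T
    W≡T = trans (cong sum (map-cong-local (All.tabulate work≡))) (plan-sum plan)

    value≤T : ∀ obj → value I σ obj ℚ.≤ fromℕ T
    value≤T totalWork         = ℚ.≤-reflexive (trans totalWork≡W (cong fromℕ W≡T))
    value≤T weightedCompleted = ℚ.≤-reflexive (trans weightedCompleted≡W (cong fromℕ W≡T))
    value≤T makespan          = foldr-⊔-lub _ (0≤fromℕ T) ends
      where
      ends : ∀ i → maybe′ (λ s → s ℚ.+ fromℕ (processing i)) 0ℚ (σ i) ℚ.≤ fromℕ T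
      ends i = case executed (toℕ i) ≟ 0 of λ where
        (yes e≡0) → subst (λ m → maybe′ (λ s → s ℚ.+ fromℕ (processing i)) 0ℚ m ℚ.≤ fromℕ T)
          (sym (cong (λ k → if k ≡ᵇ 0 then nothing else just (fromℕ (start (toℕ i)))) e≡0)) (0≤fromℕ T)
        (no e≢0) → subst (λ m → maybe′ (λ s → s ℚ.+ fromℕ (processing i)) 0ℚ m ℚ.≤ fromℕ T)
          (sym (decode-executed {i} e≢0)) (subst (ℚ._≤ fromℕ T) (sym (end≡ i)) (fromℕ-mono-≤ (end≤T i e≢0)))

    optimal : ∀ obj → Optimal obj I σ
    optimal obj = feasible , λ σ′ F′ →
      let module B = LowerBound σ′ F′ L sorted sound complete in
      ℚ.≤-trans (value≤T obj) (ℚ.≤-trans (fromℕ-mono-≤ (minimal B.W B.selection)) (B.W≤value obj))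

  -- `T ≡ 0` empties the list of relevant jobs, so under any schedule the processor is idle at time
  -- 0. A zero-length job is executable at that instant, since no feasible start precedes time 0.
  infeasible-instance : ∀ {reported executed start} (S : Solved reported executed start) → Solved.T S ≡ 0 →
    ∀ j → j < n → len j ≡ 0 → ¬ (∃[ σ ] Feasible I σ)
  infeasible-instance S T≡0 j j<n t≡0 (σ , F) = busy 0ℚ idle i
      ( (λ (s , σi≡ , s<0) → ℚ.<-irrefl refl (ℚ.≤-<-trans (subst (ℚ._≤ s) (arrival≡0 i) (proj₁ (window i s σi≡))) s<0))
      , ℚ.≤-reflexive (arrival≡0 i)
      , p+r≤q⇒p≤q-r 0ℚ _ _ (subst (ℚ._≤ fromℕ (deadline i))
          (sym (trans (ℚ.+-identityˡ _) (trans (len≡ i) (cong fromℕ (trans (cong len (toℕ-fromℕ< j<n)) t≡0)))))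
          (0≤fromℕ (deadline i))))
    where
    open Solved S
    open Feasible F
    open LowerBound σ F L sorted sound complete using (len≤due)
    i = fromℕ< j<n
    L≡[] : L ≡ []
    L≡[] = plan-empty (All.map proj₁ sound) T≡0 (subst (λ v → Plan _ _ v L T) T≡0 plan)
    idle : ¬ (∃[ i ] InProcess I σ i 0ℚ)
    idle (k , s , σk≡ , s≤0 , 0<) = case subst (toℕ k ∈_) L≡[]
        (complete (toℕ k) (n≢0⇒n>0 pos , len≤due (toℕ k) (trans (padMaybe-toℕ σ k) σk≡)) (toℕ<n k)) of λ ()
      where
      pos : len (toℕ k) ≢ 0
      pos t≡0 = ℚ.<-irrefl refl (ℚ.<-≤-trans 0< (subst (ℚ._≤ 0ℚ)
        (sym (trans (cong (s ℚ.+_) (trans (len≡ k) (cong fromℕ t≡0))) (ℚ.+-identityʳ s))) s≤0))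

  correct : ∀ obj s → SolvedAt s → Correct obj I (output I s)
  correct obj ⟨ r , m ⟩ S with r 0 | S
  ... | zero  | S′ =
    let T≡0 , j , j<n , t≡0 = Solved.failure S′ refl in
    (fromℕ< j<n , trans (sym (pad-toℕ processing (fromℕ< j<n))) (trans (cong len (toℕ-fromℕ< j<n)) t≡0))
    , infeasible-instance S′ T≡0 j j<n t≡0
  ... | suc _ | S′ = Attained.optimal S′ (Solved.success S′ λ ()) obj

  conclude : ∀ obj c → Exec program (input I) SolvedAt (U * c) →
    Σ[ s ∈ State ] Σ[ k ∈ ℕ ] (Run program (input I) s k
      × Correct obj I (output I s)
      × k ≤ c * 6 * ((1 ⊔ maxDeadline I) * (1 ⊔ n)))
  conclude obj c (s , k , run , solved , k≤) =
    s , k , run , correct obj s solved , ≤-trans k≤ (cost≤ c (maxDeadline I) n)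

  solve : Exec program (input I) SolvedAt (U * 251)
  solve = exec-program {input I} refl refl refl

theorem7 : ∀ (obj : Objective) → Σ[ p ∈ Program ] Σ[ C ∈ ℕ ]
    (∀ (I : Instance) → ReleasedAtZero I →
    Σ[ s ∈ State ] Σ[ k ∈ ℕ ] (Run p (input I) s k
    × Correct obj I (output I s)
    × k ≤ C * ((1 ⊔ maxDeadline I) * (1 ⊔ Instance.n I))))
theorem7 obj = program , 251 * 6 , λ I released →
  Bridge.conclude I released obj 251 (Bridge.solve I released)
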